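{- Let $m$ be an odd prime, and let $r$ and $s$ be positive integers such that either $s$ is even, or $s$ is odd and $r$ divides $sm$. Then there is a tight chiral polyhedron of type $\{2rm, s m^2\}$.
   Context: An (abstract) polyhedron is a partially ordered set whose elements have rank $0$, $1$, $2$ (vertices, edges, faces), incidence meaning comparability, such that every edge is incident to exactly two vertices and two faces, whenever a vertex is incident to a face exactly two edges are incident to both, the incidence graph is connected, and for each vertex or face the subgraph of the incidence graph induced on its neighbours is connected. A flag is a mutually incident (vertex, edge, face) triple; $\Phi^i$ is the flag differing from $\Phi$ exactly in its rank-$i$ element. Type $\{p,q\}$: faces are incident to $p$ edges and vertices to $q$ edges. An automorphism is an incidence-preserving bijection. The polyhedron is chiral if its flags split into two classes with $\Phi,\Phi^i$ always in different classes and the automorphism group transitive on each class but not on all flags. A polyhedron of type $\{p,q\}$ is tight if it has exactly $2pq$ flags. -}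

module Defs where

open import Data.Nat using (ℕ; zero; suc; _+_; _*_)
open import Data.Bool using (Bool; true; false; _∧_; if_then_else_)
open import Data.Fin using (Fin)
import Data.Fin as F
open import Data.Sum using (_⊎_; inj₁; inj₂)
open import Data.Product using (Σ; ∃; _×_; _,_)
open import Data.Empty using (⊥)
open import Data.Unit using (⊤)
open import Relation.Nullary using (¬_)
open import Relation.Binary.PropositionalEquality using (_≡_; _≢_)
open import Relation.Binary.Construct.Closure.ReflexiveTransitive using (Star)
open import Function.Bundles using (_↔_; Inverse)
open import Function.Base using (_∘_)

sumFin : ∀ n → (Fin n → ℕ) → ℕ
sumFin zero    _ = 0
sumFin (suc n) g = g F.zero + sumFin n (g ∘ F.suc)

count : ∀ {n} → (Fin n → Bool) → ℕ
count {n} P = sumFin n (λ i → if P i then 1 else 0)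

-- A finite rank-2 incidence structure: vertices (rank 0), edges (rank 1),
-- faces (rank 2), each a finite set, with the partial order given by
-- decidable (Bool-valued) relations between elements of different ranks.

record Structure : Set where
  field
    nV nE nF : ℕ
    VE : Fin nV → Fin nE → Bool
    EF : Fin nE → Fin nF → Bool
    VF : Fin nV → Fin nF → Bool

module _ (P : Structure) where
  open Structure P

  Elem : Set
  Elem = Fin nV ⊎ (Fin nE ⊎ Fin nF)

  vx : Fin nV → Elem
  vx = inj₁
  ed : Fin nE → Elem
  ed = inj₂ ∘ inj₁
  fc : Fin nF → Elem
  fc = inj₂ ∘ inj₂

  Inc : Elem → Elem → Set
  Inc (inj₁ v)        (inj₂ (inj₁ e)) = VE v e ≡ true
  Inc (inj₁ v)        (inj₂ (inj₂ f)) = VF v f ≡ true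
  Inc (inj₂ (inj₁ e)) (inj₁ v)        = VE v e ≡ true
  Inc (inj₂ (inj₁ e)) (inj₂ (inj₂ f)) = EF e f ≡ true
  Inc (inj₂ (inj₂ f)) (inj₁ v)        = VF v f ≡ true
  Inc (inj₂ (inj₂ f)) (inj₂ (inj₁ e)) = EF e f ≡ true
  Inc _               _               = ⊥

  Induced : (Elem → Set) → Elem → Elem → Set
  Induced N a b = N a × N b × Inc a b

  ConnectedOn : (Elem → Set) → Set
  ConnectedOn N = ∀ a b → N a → N b → Star (Induced N) a b

  record IsPolyhedron : Set where
    field
      trans-VEF : ∀ v e f → VE v e ≡ true → EF e f ≡ true → VF v f ≡ true
      edge-two-vertices : ∀ e → count (λ v → VE v e) ≡ 2
      edge-two-faces    : ∀ e → count (λ f → EF e f) ≡ 2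
      diamond : ∀ v f → VF v f ≡ true → count (λ e → VE v e ∧ EF e f) ≡ 2
      connected : ∀ a b → Star Inc a b
      vertex-connected : ∀ v → ConnectedOn (Inc (vx v))
      face-connected   : ∀ f → ConnectedOn (Inc (fc f))

  HasType : ℕ → ℕ → Set
  HasType p q = (∀ f → count (λ e → EF e f) ≡ p) × (∀ v → count (λ e → VE v e) ≡ q)

  record Flag : Set where
    constructor flag
    field
      fv : Fin nV
      fe : Fin nE
      ff : Fin nF
      ve : VE fv fe ≡ true
      ef : EF fe ff ≡ true
  open Flag

  numFlags : ℕ
  numFlags = sumFin nV λ v → sumFin nE λ e → count (λ f → VE v e ∧ EF e f)

  Tight : ℕ → ℕ → Set
  Tight p q = numFlags ≡ 2 * p * q

  Adj : Fin 3 → Flag → Flag → Set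
  Adj F.zero                   Φ Ψ = fv Φ ≢ fv Ψ × fe Φ ≡ fe Ψ × ff Φ ≡ ff Ψ
  Adj (F.suc F.zero)           Φ Ψ = fv Φ ≡ fv Ψ × fe Φ ≢ fe Ψ × ff Φ ≡ ff Ψ
  Adj (F.suc (F.suc F.zero))   Φ Ψ = fv Φ ≡ fv Ψ × fe Φ ≡ fe Ψ × ff Φ ≢ ff Ψ

  record Automorphism : Set where
    field
      αV : Fin nV ↔ Fin nV
      αE : Fin nE ↔ Fin nE
      αF : Fin nF ↔ Fin nF
      pres-VE : ∀ v e → VE (Inverse.to αV v) (Inverse.to αE e) ≡ VE v e
      pres-EF : ∀ e f → EF (Inverse.to αE e) (Inverse.to αF f) ≡ EF e f
      pres-VF : ∀ v f → VF (Inverse.to αV v) (Inverse.to αF f) ≡ VF v f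

  MapsTo : Automorphism → Flag → Flag → Set
  MapsTo α Φ Ψ = Inverse.to αV (fv Φ) ≡ fv Ψ
               × Inverse.to αE (fe Φ) ≡ fe Ψ
               × Inverse.to αF (ff Φ) ≡ ff Ψ
    where open Automorphism α

  FlagTransitiveOn : (Flag → Set) → Set
  FlagTransitiveOn C = ∀ Φ Ψ → C Φ → C Ψ → Σ Automorphism λ α → MapsTo α Φ Ψ

  Chiral : Set
  Chiral = Σ (Flag → Bool) λ c →
             (∀ i Φ Ψ → Adj i Φ Ψ → c Φ ≢ c Ψ)
           × (∀ b → FlagTransitiveOn (λ Φ → c Φ ≡ b))
           × ¬ FlagTransitiveOn (λ _ → ⊤)

{-# OPTIONS --safe #-}
-- A group G = ⟨x, y⟩ with (xy)² = 1, |G| = pq, ⟨x⟩ of order p, ⟨y⟩ of order q and ⟨x⟩ ∩ ⟨y⟩ = 1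
-- gives a tight polyhedron of type {p, q}: vertices, edges and faces are the left cosets of ⟨y⟩,
-- ⟨xy⟩ and ⟨x⟩.  Every vertex then lies on every face, so a corner (vertex, face) is the same as
-- an element g of G, and each corner carries two flags, containing the edges g⟨xy⟩ and gy⟨xy⟩.
-- Left translations are transitive on each of the two kinds of flags; an automorphism mixing them
-- would force x ↦ x⁻¹, y ↦ y⁻¹ to extend to G.
--
-- G is built from its subgroup N = ⟨w, y⟩ of index 2, w = x².  If r ∣ sm, take for N a quotient of
-- the Heisenberg group in which the commutator of w and y is a power of z = (ywy)^(sm), an element
-- of order m that is central in N.  Inverting the generators fixes the commutator but inverts z,
-- so no reflection exists.
-- If s is even, write r = mᵃρ and s = mᵇς with ρ, ς prime to m.  For a ≤ b + 1, multiply the group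
-- above for (mᵃ, mᵇ) by the metacyclic group in which y inverts w and w, y have orders ρ, ς;
-- otherwise take the dual of this construction for r = mᵇ⁺¹ς/2 and s = 2mᵃ⁻¹ρ.
module Submission where

open import Defs

-- The direct product with the metacyclic group is formed on the subgroups `N`, because `x` has even
-- order in every factor while the orders of `w`, and those of `y`, can be made coprime. The
-- extension by `x` is carried out once, afterwards; it asks only for an automorphism `η` of `N`
-- with `η w = w⁻¹ww = w` and `η y = w⁻¹y⁻¹`. On the exponents of the Heisenberg group `η` has
-- determinant -1, so it inverts the commutator of `w` and `y` together with `z`. Inverting both
-- generators has determinant 1, so it keeps the commutator but not `z = (ywy)^(sm)`: this clash of
-- signs is the whole obstruction. The condition `r ∣ sm` comes from `z = y^(2sm) w^(sm)`: for
-- `z^m = 1` the power `w^(sm²)` has to vanish, and `w` has order `rm`. An inverting `y` must have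
-- even order, which is where an even `s` enters; then both degrees are even, so either generator
-- can be the one that is squared, and duality becomes available.

-- Counting finite sets by sums of indicators.

module Counting where

  open import Data.Bool using (Bool; true; false; _∧_; _∨_; if_then_else_)
  open import Data.Empty using (⊥-elim)
  open import Data.Fin using (Fin; zero; suc; _≟_)
  open import Data.Nat using (ℕ; zero; suc; _+_; _*_)
  open import Data.Nat.Properties using (+-assoc; +-comm; *-zeroʳ; *-identityʳ; *-distribˡ-+)
  open import Data.Fin.Properties using (suc-injective)
  open import Data.Product using (∃; _×_; _,_)
  open import Data.Sum using (_⊎_; inj₁; inj₂; [_,_]′)
  open import Function.Base using (_∘_)
  open import Relation.Nullary using (yes; no; does)
  open import Relation.Nullary.Decidable using (dec-true)
  open import Relation.Binary.PropositionalEquality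

  ind : Bool → ℕ
  ind b = if b then 1 else 0

  sumFin-cong : ∀ n {f g : Fin n → ℕ} → (∀ i → f i ≡ g i) → sumFin n f ≡ sumFin n g
  sumFin-cong zero    f≗g = refl
  sumFin-cong (suc n) f≗g = cong₂ _+_ (f≗g zero) (sumFin-cong n (f≗g ∘ suc))

  sumFin-const : ∀ n k → sumFin n (λ _ → k) ≡ n * k
  sumFin-const zero    k = refl
  sumFin-const (suc n) k = cong (k +_) (sumFin-const n k)

  sumFin-*ˡ : ∀ n k (f : Fin n → ℕ) → sumFin n (λ i → k * f i) ≡ k * sumFin n f
  sumFin-*ˡ zero    k f = sym (*-zeroʳ k)
  sumFin-*ˡ (suc n) k f = trans (cong (k * f zero +_) (sumFin-*ˡ n k (f ∘ suc)))
                                (sym (*-distribˡ-+ k (f zero) _))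

  sumFin-+ : ∀ n (f g : Fin n → ℕ) → sumFin n (λ i → f i + g i) ≡ sumFin n f + sumFin n g
  sumFin-+ zero    f g = refl
  sumFin-+ (suc n) f g = begin
    (f₀ + g₀) + sumFin n (λ i → f (suc i) + g (suc i))  ≡⟨ cong (f₀ + g₀ +_) (sumFin-+ n (f ∘ suc) (g ∘ suc)) ⟩
    (f₀ + g₀) + (Σf + Σg)                                ≡⟨ +-assoc f₀ g₀ _ ⟩
    f₀ + (g₀ + (Σf + Σg))                                ≡⟨ cong (f₀ +_) (sym (+-assoc g₀ Σf Σg)) ⟩
    f₀ + ((g₀ + Σf) + Σg)                                ≡⟨ cong (λ k → f₀ + (k + Σg)) (+-comm g₀ Σf) ⟩
    f₀ + ((Σf + g₀) + Σg)                                ≡⟨ cong (f₀ +_) (+-assoc Σf g₀ Σg) ⟩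
    f₀ + (Σf + (g₀ + Σg))                                ≡⟨ sym (+-assoc f₀ Σf _) ⟩
    (f₀ + Σf) + (g₀ + Σg)                                ∎
    where
    open ≡-Reasoning
    f₀ = f zero
    g₀ = g zero
    Σf = sumFin n (f ∘ suc)
    Σg = sumFin n (g ∘ suc)

  sumFin-swap : ∀ n k (f : Fin n → Fin k → ℕ) →
    sumFin n (λ i → sumFin k (f i)) ≡ sumFin k (λ j → sumFin n (λ i → f i j))
  sumFin-swap zero    k f = sym (trans (sumFin-const k 0) (*-zeroʳ k))
  sumFin-swap (suc n) k f = trans (cong (sumFin k (f zero) +_) (sumFin-swap n k (f ∘ suc)))
                                  (sym (sumFin-+ k (f zero) _))

  count-singleton : ∀ {n} (P : Fin n → Bool) (j : Fin n) → P j ≡ true →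
    (∀ i → P i ≡ true → i ≡ j) → count P ≡ 1
  count-singleton {suc n} P zero Pj only = begin
    ind (P zero) + sumFin n (ind ∘ P ∘ suc)  ≡⟨ cong₂ _+_ (cong ind Pj) (sumFin-cong n others) ⟩
    1 + sumFin n (λ _ → 0)                   ≡⟨ cong suc (trans (sumFin-const n 0) (*-zeroʳ n)) ⟩
    1                                        ∎
    where
    open ≡-Reasoning
    others : ∀ i → ind (P (suc i)) ≡ 0
    others i with P (suc i) in eq
    ... | false = refl
    ... | true  with () ← only (suc i) eq
  count-singleton {suc n} P (suc j) Pj only = cong₂ _+_ first
    (count-singleton (P ∘ suc) j Pj λ i Pi → suc-injective (only (suc i) Pi))
    where
    first : ind (P zero) ≡ 0
    first with P zero in eq
    ... | false = refl
    ... | true  with () ← only zero eq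

  true-dec : ∀ {n} {i j : Fin n} → does (i ≟ j) ≡ true → i ≡ j
  true-dec {i = i} {j} d with i ≟ j
  ... | yes i≡j = i≡j

  -- Double counting of the graph of h.
  count-image : ∀ {n k} (P : Fin k → Bool) (h : Fin n → Fin k) →
    (∀ {i j} → h i ≡ h j → i ≡ j) → (∀ i → P (h i) ≡ true) →
    (∀ e → P e ≡ true → ∃ λ i → h i ≡ e) → count P ≡ n
  count-image {n} {k} P h inj sound complete = begin
    count P                                                       ≡⟨ sumFin-cong k fibre ⟩
    sumFin k (λ e → sumFin n (λ i → ind (does (h i ≟ e))))        ≡⟨ sumFin-swap k n _ ⟩
    sumFin n (λ i → count (λ e → does (h i ≟ e)))                 ≡⟨ sumFin-cong n (λ i →
      count-singleton _ (h i) (dec-true (h i ≟ h i) refl) λ e d → sym (true-dec d)) ⟩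
    sumFin n (λ _ → 1)                                            ≡⟨ sumFin-const n 1 ⟩
    n * 1                                                         ≡⟨ *-identityʳ n ⟩
    n                                                             ∎
    where
    open ≡-Reasoning
    fibre : ∀ e → ind (P e) ≡ sumFin n (λ i → ind (does (h i ≟ e)))
    fibre e with P e in eq
    ... | true with complete e eq
    ...   | i , hi≡e = sym (count-singleton _ i (dec-true (h i ≟ e) hi≡e)
                        λ j d → inj (trans (true-dec d) (sym hi≡e)))
    fibre e | false = sym (trans (sumFin-cong n none) (trans (sumFin-const n 0) (*-zeroʳ n)))
      where
      none : ∀ i → ind (does (h i ≟ e)) ≡ 0
      none i with h i ≟ e
      ... | no _ = refl
      ... | yes hi≡e with () ← trans (sym (sound i)) (trans (cong P hi≡e) eq)

  count-pair : ∀ {k} (P : Fin k → Bool) {a b : Fin k} → a ≢ b → P a ≡ true → P b ≡ true →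
    (∀ e → P e ≡ true → a ≡ e ⊎ b ≡ e) → count P ≡ 2
  count-pair P {a} {b} a≢b Pa Pb only = count-image P h inj sound complete
    where
    h : Fin 2 → Fin _
    h zero       = a
    h (suc zero) = b
    inj : ∀ {i j} → h i ≡ h j → i ≡ j
    inj {zero}     {zero}     _  = refl
    inj {zero}     {suc zero} eq = ⊥-elim (a≢b eq)
    inj {suc zero} {zero}     eq = ⊥-elim (a≢b (sym eq))
    inj {suc zero} {suc zero} _  = refl
    sound : ∀ i → P (h i) ≡ true
    sound zero       = Pa
    sound (suc zero) = Pb
    complete : ∀ e → P e ≡ true → ∃ λ i → h i ≡ e
    complete e Pe = [ (zero ,_) , (suc zero ,_) ]′ (only e Pe)

  true-∨ : ∀ {b c} → b ∨ c ≡ true → b ≡ true ⊎ c ≡ true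
  true-∨ {true}  _ = inj₁ refl
  true-∨ {false} c = inj₂ c

  ∨-trueˡ : ∀ {b c} → b ≡ true → b ∨ c ≡ true
  ∨-trueˡ refl = refl

  ∨-trueʳ : ∀ {b c} → c ≡ true → b ∨ c ≡ true
  ∨-trueʳ {true}  _ = refl
  ∨-trueʳ {false} c = c

  true-∧ : ∀ {b c} → b ∧ c ≡ true → b ≡ true × c ≡ true
  true-∧ {true} {true} _ = refl , refl

  bool-ext : ∀ {b c} → (b ≡ true → c ≡ true) → (c ≡ true → b ≡ true) → b ≡ c
  bool-ext {true}  {_}     f g = sym (f refl)
  bool-ext {false} {true}  f g = g refl
  bool-ext {false} {false} f g = refl

-- The tight polyhedron of a group, and its chirality.

module Rotary where

  open Counting
  open import Algebra.Bundles using (Group)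
  import Algebra.Properties.Group as GroupProperties
  import Algebra.Properties.Monoid.Mult as Mult
  import Relation.Binary.Reasoning.Setoid as SetoidReasoning
  open import Data.Bool using (Bool; true; false; _∧_; _∨_; if_then_else_)
  open import Data.Empty using (⊥; ⊥-elim)
  open import Data.Fin using (Fin; zero; suc; _≟_)
  open import Data.Nat using (ℕ; zero; suc; _*_)
  open import Data.Nat.Properties using (*-assoc; *-comm)
  open import Data.Product using (∃; _×_; _,_; proj₁; proj₂)
  import Data.Sum
  open import Data.Sum using (_⊎_; inj₁; inj₂)
  open import Data.Unit using (⊤; tt)
  open import Function.Bundles using (_↔_; Inverse; mk↔ₛ′)
  open import Level using (0ℓ)
  open import Relation.Nullary using (¬_; does)
  open import Relation.Nullary.Decidable using (dec-true)
  open import Relation.Binary.Construct.Closure.ReflexiveTransitive using (Star; _◅_; _◅◅_; reverse) renaming (ε to ⋆ε)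
  open import Relation.Binary.PropositionalEquality as ≡ using (_≡_; _≢_; cong; cong₂)

  -- `vtx`, `fac` and `edge` number the left cosets of ⟨y⟩, ⟨x⟩ and ⟨xy⟩. `vtx-fac-injective`
  -- encodes ⟨x⟩ ∩ ⟨y⟩ = 1, and `dart` says that every coset of ⟨y⟩ meets every coset of ⟨x⟩;
  -- together they stand for |G| = pq. Equality is a setoid relation, so quotient groups need no
  -- normal forms.
  record TightRotary (p q : ℕ) : Set₁ where
    field
      group : Group 0ℓ 0ℓ
    open Group group public
    open Mult monoid public using () renaming (_×_ to pow)
    field
      x y : Carrier
    τ : Carrier
    τ = x ∙ y
    field
      τ-involutive : τ ∙ τ ≈ ε
      x≉ε : ¬ x ≈ ε
      y≉ε : ¬ y ≈ ε
      vtx : Carrier → Fin p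
      fac : Carrier → Fin q
      vtx-cong : ∀ {g h} → g ≈ h → vtx g ≡ vtx h
      fac-cong : ∀ {g h} → g ≈ h → fac g ≡ fac h
      vtx-y : ∀ g → vtx (g ∙ y) ≡ vtx g
      fac-x : ∀ g → fac (g ∙ x) ≡ fac g
      vtx-coset : ∀ {g h} → vtx g ≡ vtx h → ∃ λ k → h ≈ g ∙ pow k y
      fac-coset : ∀ {g h} → fac g ≡ fac h → ∃ λ k → h ≈ g ∙ pow k x
      vtx-fac-injective : ∀ {g h} → vtx g ≡ vtx h → fac g ≡ fac h → g ≈ h
      dart : Fin p → Fin q → Carrier
      vtx-dart : ∀ v f → vtx (dart v f) ≡ v
      fac-dart : ∀ v f → fac (dart v f) ≡ f
      nE : ℕ
      edge : Carrier → Fin nE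
      edge-cong : ∀ {g h} → g ≈ h → edge g ≡ edge h
      edge-τ : ∀ g → edge (g ∙ τ) ≡ edge g
      edge-coset : ∀ {g h} → edge g ≡ edge h → h ≈ g ⊎ h ≈ g ∙ τ
      rep : Fin nE → Carrier
      edge-rep : ∀ e → edge (rep e) ≡ e

  -- Up to a left translation, such a `φ` is the automorphism inverting both generators. It is
  -- stated for arbitrary maps because an automorphism of the polyhedron yields a map on corners
  -- first.
  IsChiral : ∀ {p q} → TightRotary p q → Set
  IsChiral T = (φ : Carrier → Carrier) → (∀ {g h} → g ≈ h → φ g ≈ φ h) →
               (∀ g → φ (g ∙ x) ≈ φ g ∙ x ⁻¹) → (∀ g → φ (g ∙ y) ≈ φ g ∙ y ⁻¹) → ⊥
    where open TightRotary T

  module Polyhedron {p q : ℕ} (T : TightRotary p q) where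
    open TightRotary T
    open GroupProperties group
    open SetoidReasoning setoid

    yτ≈x⁻¹ : y ∙ τ ≈ x ⁻¹
    yτ≈x⁻¹ = inverseʳ-unique x (y ∙ τ) (trans (sym (assoc x y τ)) τ-involutive)

    τx≈y⁻¹ : τ ∙ x ≈ y ⁻¹
    τx≈y⁻¹ = inverseˡ-unique (τ ∙ x) y (trans (assoc τ x y) τ-involutive)

    gyτ≈gx⁻¹ : ∀ g → g ∙ y ∙ τ ≈ g ∙ x ⁻¹
    gyτ≈gx⁻¹ g = trans (assoc g y τ) (∙-congˡ yτ≈x⁻¹)

    vtx-y⁻¹ : ∀ g → vtx (g ∙ y ⁻¹) ≡ vtx g
    vtx-y⁻¹ g = ≡.trans (≡.sym (vtx-y (g ∙ y ⁻¹))) (vtx-cong (//-rightDividesˡ y g))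

    fac-x⁻¹ : ∀ g → fac (g ∙ x ⁻¹) ≡ fac g
    fac-x⁻¹ g = ≡.trans (≡.sym (fac-x (g ∙ x ⁻¹))) (fac-cong (//-rightDividesˡ x g))

    vtx-τ : ∀ g → vtx (g ∙ τ) ≡ vtx (g ∙ x)
    vtx-τ g = ≡.trans (vtx-cong (sym (assoc g x y))) (vtx-y (g ∙ x))

    fac-τ : ∀ g → fac (g ∙ τ) ≡ fac (g ∙ y ⁻¹)
    fac-τ g = ≡.trans (≡.sym (fac-x (g ∙ τ))) (fac-cong (trans (assoc g τ x) (∙-congˡ τx≈y⁻¹)))

    fac-yτ : ∀ g → fac (g ∙ y ∙ τ) ≡ fac g
    fac-yτ g = ≡.trans (fac-cong (gyτ≈gx⁻¹ g)) (fac-x⁻¹ g)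

    vtx-x≢ : ∀ g → vtx (g ∙ x) ≢ vtx g
    vtx-x≢ g eq = x≉ε (identityʳ-unique g x (vtx-fac-injective eq (fac-x g)))

    fac-y≢ : ∀ g → fac (g ∙ y) ≢ fac g
    fac-y≢ g eq = y≉ε (identityʳ-unique g y (vtx-fac-injective (vtx-y g) eq))

    vtx-τ≢ : ∀ g → vtx (g ∙ τ) ≢ vtx g
    vtx-τ≢ g eq = vtx-x≢ g (≡.trans (≡.sym (vtx-τ g)) eq)

    fac-τ≢ : ∀ g → fac (g ∙ τ) ≢ fac g
    fac-τ≢ g eq = fac-y≢ (g ∙ y ⁻¹)
      (≡.trans (fac-cong (//-rightDividesˡ y g)) (≡.sym (≡.trans (≡.sym (fac-τ g)) eq)))

    edge-y≢ : ∀ g → edge g ≢ edge (g ∙ y)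
    edge-y≢ g eq with edge-coset eq
    ... | inj₁ gy≈g  = y≉ε (identityʳ-unique g y gy≈g)
    ... | inj₂ gy≈gτ = x≉ε (identityˡ-unique x y (sym (∙-cancelˡ g _ _ gy≈gτ)))

    vtx-pow : ∀ g k → vtx (g ∙ pow k y) ≡ vtx g
    vtx-pow g zero    = vtx-cong (identityʳ g)
    vtx-pow g (suc k) = ≡.trans (vtx-cong (sym (assoc g y _))) (≡.trans (vtx-pow (g ∙ y) k) (vtx-y g))

    fac-pow : ∀ g k → fac (g ∙ pow k x) ≡ fac g
    fac-pow g zero    = fac-cong (identityʳ g)
    fac-pow g (suc k) = ≡.trans (fac-cong (sym (assoc g x _))) (≡.trans (fac-pow (g ∙ x) k) (fac-x g))

    vtx-∙ˡ : ∀ k {g h} → vtx g ≡ vtx h → vtx (k ∙ g) ≡ vtx (k ∙ h)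
    vtx-∙ˡ k {g} eq with vtx-coset eq
    ... | j , h≈ = ≡.sym (≡.trans (vtx-cong (trans (∙-congˡ h≈) (sym (assoc k g _)))) (vtx-pow (k ∙ g) j))

    fac-∙ˡ : ∀ k {g h} → fac g ≡ fac h → fac (k ∙ g) ≡ fac (k ∙ h)
    fac-∙ˡ k {g} eq with fac-coset eq
    ... | j , h≈ = ≡.sym (≡.trans (fac-cong (trans (∙-congˡ h≈) (sym (assoc k g _)))) (fac-pow (k ∙ g) j))

    edge-∙ˡ : ∀ k {g h} → edge g ≡ edge h → edge (k ∙ g) ≡ edge (k ∙ h)
    edge-∙ˡ k {g} eq with edge-coset eq
    ... | inj₁ h≈g  = edge-cong (∙-congˡ (sym h≈g))
    ... | inj₂ h≈gτ = ≡.sym (≡.trans (edge-cong (trans (∙-congˡ h≈gτ) (sym (assoc k g τ)))) (edge-τ (k ∙ g)))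

    -- An edge consists of the two darts `rep e` and `rep e ∙ τ`; its ends and its sides are the
    -- cosets through these darts.
    poly : Structure
    poly = record
      { nV = p
      ; nE = nE
      ; nF = q
      ; VE = λ v e → does (vtx (rep e) ≟ v) ∨ does (vtx (rep e ∙ τ) ≟ v)
      ; EF = λ e f → does (fac (rep e) ≟ f) ∨ does (fac (rep e ∙ τ) ≟ f)
      ; VF = λ _ _ → true
      }

    open Structure poly using (VE; EF)

    VE-edge : ∀ {v e} g → vtx g ≡ v → edge g ≡ e → VE v e ≡ true
    VE-edge {v} {e} g ≡.refl eq with edge-coset (≡.trans (edge-rep e) (≡.sym eq))
    ... | inj₁ g≈  = ∨-trueˡ (dec-true (_ ≟ v) (vtx-cong (sym g≈)))
    ... | inj₂ g≈τ = ∨-trueʳ (dec-true (_ ≟ v) (vtx-cong (sym g≈τ)))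

    EF-edge : ∀ {e f} g → fac g ≡ f → edge g ≡ e → EF e f ≡ true
    EF-edge {e} {f} g ≡.refl eq with edge-coset (≡.trans (edge-rep e) (≡.sym eq))
    ... | inj₁ g≈  = ∨-trueˡ (dec-true (_ ≟ f) (fac-cong (sym g≈)))
    ... | inj₂ g≈τ = ∨-trueʳ (dec-true (_ ≟ f) (fac-cong (sym g≈τ)))

    VE-dart : ∀ {v e} → VE v e ≡ true → ∃ λ g → vtx g ≡ v × edge g ≡ e
    VE-dart {v} {e} ve with true-∨ ve
    ... | inj₁ d = rep e , true-dec d , edge-rep e
    ... | inj₂ d = rep e ∙ τ , true-dec d , ≡.trans (edge-τ (rep e)) (edge-rep e)

    EF-dart : ∀ {e f} → EF e f ≡ true → ∃ λ g → fac g ≡ f × edge g ≡ e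
    EF-dart {e} {f} ef with true-∨ ef
    ... | inj₁ d = rep e , true-dec d , edge-rep e
    ... | inj₂ d = rep e ∙ τ , true-dec d , ≡.trans (edge-τ (rep e)) (edge-rep e)

    edge-vertices : ∀ g {v} → VE v (edge g) ≡ true → vtx g ≡ v ⊎ vtx (g ∙ τ) ≡ v
    edge-vertices g ve with VE-dart ve
    ... | d , ≡.refl , eq with edge-coset (≡.sym eq)
    ...   | inj₁ d≈g  = inj₁ (vtx-cong (sym d≈g))
    ...   | inj₂ d≈gτ = inj₂ (vtx-cong (sym d≈gτ))

    edge-faces : ∀ g {f} → EF (edge g) f ≡ true → fac g ≡ f ⊎ fac (g ∙ τ) ≡ f
    edge-faces g ef with EF-dart ef
    ... | d , ≡.refl , eq with edge-coset (≡.sym eq)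
    ...   | inj₁ d≈g  = inj₁ (fac-cong (sym d≈g))
    ...   | inj₂ d≈gτ = inj₂ (fac-cong (sym d≈gτ))

    -- Let `d` be the dart of the edge at this vertex. If `d` itself lies on the face, it is `g`.
    -- Otherwise `d ∙ τ` does, and `fac (d ∙ τ) = fac (d ∙ y⁻¹)` identifies `g` with `d ∙ y⁻¹`.
    corner-edges : ∀ g {e} → VE (vtx g) e ≡ true → EF e (fac g) ≡ true → edge g ≡ e ⊎ edge (g ∙ y) ≡ e
    corner-edges g ve ef with VE-dart ve
    ... | d , vd , ≡.refl with edge-faces d ef
    ...   | inj₁ fd = inj₁ (edge-cong (vtx-fac-injective (≡.sym vd) (≡.sym fd)))
    ...   | inj₂ fdτ = inj₂ (edge-cong (begin
      g ∙ y          ≈⟨ ∙-congʳ (vtx-fac-injective (≡.trans (≡.sym vd) (≡.sym (vtx-y⁻¹ d)))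
                                                    (≡.trans (≡.sym fdτ) (fac-τ d))) ⟩
      d ∙ y ⁻¹ ∙ y   ≈⟨ //-rightDividesˡ y d ⟩
      d              ∎))

    VE-first : ∀ g → VE (vtx g) (edge g) ≡ true
    VE-first g = VE-edge g ≡.refl ≡.refl

    EF-first : ∀ g → EF (edge g) (fac g) ≡ true
    EF-first g = EF-edge g ≡.refl ≡.refl

    VE-second : ∀ g → VE (vtx g) (edge (g ∙ y)) ≡ true
    VE-second g = VE-edge (g ∙ y) (vtx-y g) ≡.refl

    EF-second : ∀ g → EF (edge (g ∙ y)) (fac g) ≡ true
    EF-second g = EF-edge (g ∙ y ∙ τ) (fac-yτ g) (edge-τ (g ∙ y))

    -- Degrees

    corner-count : ∀ g → count (λ e → VE (vtx g) e ∧ EF e (fac g)) ≡ 2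
    corner-count g = count-pair _ (edge-y≢ g)
      (cong₂ _∧_ (VE-first g) (EF-first g)) (cong₂ _∧_ (VE-second g) (EF-second g))
      λ e both → corner-edges g (proj₁ (true-∧ both)) (proj₂ (true-∧ both))

    diamond : ∀ v f → count (λ e → VE v e ∧ EF e f) ≡ 2
    diamond v f = ≡.subst₂ (λ v f → count (λ e → VE v e ∧ EF e f) ≡ 2)
      (vtx-dart v f) (fac-dart v f) (corner-count (dart v f))

    edge-two-vertices : ∀ e → count (λ v → VE v e) ≡ 2
    edge-two-vertices e = count-pair _ (λ eq → vtx-τ≢ g (≡.sym eq))
      (VE-edge g ≡.refl (edge-rep e)) (VE-edge (g ∙ τ) ≡.refl (≡.trans (edge-τ g) (edge-rep e)))
      λ v ve → edge-vertices g (≡.subst (λ e → VE v e ≡ true) (≡.sym (edge-rep e)) ve)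
      where g = rep e

    edge-two-faces : ∀ e → count (λ f → EF e f) ≡ 2
    edge-two-faces e = count-pair _ (λ eq → fac-τ≢ g (≡.sym eq))
      (EF-edge g ≡.refl (edge-rep e)) (EF-edge (g ∙ τ) ≡.refl (≡.trans (edge-τ g) (edge-rep e)))
      λ f ef → edge-faces g (≡.subst (λ e → EF e f ≡ true) (≡.sym (edge-rep e)) ef)
      where g = rep e

    -- An edge at `v` has exactly one of its two darts at `v`, and the darts at `v` are indexed by
    -- their faces.
    vertex-degree : ∀ v → count (λ e → VE v e) ≡ q
    vertex-degree v = count-image _ (λ f → edge (dart v f)) inj
      (λ f → VE-edge (dart v f) (vtx-dart v f) ≡.refl) complete
      where
      inj : ∀ {f f′} → edge (dart v f) ≡ edge (dart v f′) → f ≡ f′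
      inj {f} {f′} eq with edge-coset eq
      ... | inj₁ same = ≡.trans (≡.sym (fac-dart v f)) (≡.trans (fac-cong (sym same)) (fac-dart v f′))
      ... | inj₂ opp  = ⊥-elim (vtx-τ≢ (dart v f)
        (≡.trans (vtx-cong (sym opp)) (≡.trans (vtx-dart v f′) (≡.sym (vtx-dart v f)))))
      complete : ∀ e → VE v e ≡ true → ∃ λ f → edge (dart v f) ≡ e
      complete e ve with VE-dart ve
      ... | g , vg , eg = fac g , ≡.trans (edge-cong (vtx-fac-injective
        (≡.trans (vtx-dart v _) (≡.sym vg)) (fac-dart v _))) eg

    face-degree : ∀ f → count (λ e → EF e f) ≡ p
    face-degree f = count-image _ (λ v → edge (dart v f)) inj
      (λ v → EF-edge (dart v f) (fac-dart v f) ≡.refl) complete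
      where
      inj : ∀ {v v′} → edge (dart v f) ≡ edge (dart v′ f) → v ≡ v′
      inj {v} {v′} eq with edge-coset eq
      ... | inj₁ same = ≡.trans (≡.sym (vtx-dart v f)) (≡.trans (vtx-cong (sym same)) (vtx-dart v′ f))
      ... | inj₂ opp  = ⊥-elim (fac-τ≢ (dart v f)
        (≡.trans (fac-cong (sym opp)) (≡.trans (fac-dart v′ f) (≡.sym (fac-dart v f)))))
      complete : ∀ e → EF e f ≡ true → ∃ λ v → edge (dart v f) ≡ e
      complete e ef with EF-dart ef
      ... | g , fg , eg = vtx g , ≡.trans (edge-cong (vtx-fac-injective
        (vtx-dart _ f) (≡.trans (fac-dart _ f) (≡.sym fg)))) eg

    hasType : HasType poly p q
    hasType = face-degree , vertex-degree

    tight : Tight poly p q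
    tight = ≡.trans (sumFin-cong p at-vertex) (≡.trans (sumFin-const p (2 * q))
              (≡.trans (≡.sym (*-assoc p 2 q)) (cong (_* q) (*-comm p 2))))
      where
      at-edge : ∀ v e → count (λ f → VE v e ∧ EF e f) ≡ 2 * ind (VE v e)
      at-edge v e with VE v e
      ... | true  = edge-two-faces e
      ... | false = ≡.trans (sumFin-const q 0) (*-comm q 0)
      at-vertex : ∀ v → sumFin nE (λ e → count (λ f → VE v e ∧ EF e f)) ≡ 2 * q
      at-vertex v = ≡.trans (sumFin-cong nE (at-edge v))
        (≡.trans (sumFin-*ˡ nE 2 _) (cong (2 *_) (vertex-degree v)))

    -- Connectedness

    private
      Vx : Fin p → Elem poly
      Vx = vx poly
      Ed : Fin nE → Elem poly
      Ed = ed poly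
      Fc : Fin q → Elem poly
      Fc = fc poly

    Inc-sym : ∀ a b → Inc poly a b → Inc poly b a
    Inc-sym (inj₁ _)        (inj₂ (inj₁ _)) i = i
    Inc-sym (inj₁ _)        (inj₂ (inj₂ _)) i = i
    Inc-sym (inj₂ (inj₁ _)) (inj₁ _)        i = i
    Inc-sym (inj₂ (inj₁ _)) (inj₂ (inj₂ _)) i = i
    Inc-sym (inj₂ (inj₂ _)) (inj₁ _)        i = i
    Inc-sym (inj₂ (inj₂ _)) (inj₂ (inj₁ _)) i = i

    Induced-sym : ∀ {N a b} → Induced poly N a b → Induced poly N b a
    Induced-sym {a = a} {b} (Na , Nb , i) = Nb , Na , Inc-sym a b i

    to-base : ∀ a → Star (Inc poly) a (Fc (fac ε))
    to-base (inj₁ v)        = ≡.refl ◅ ⋆ε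
    to-base (inj₂ (inj₁ e)) = VE-edge {e = e} (rep e) ≡.refl (edge-rep e) ◅ to-base (inj₁ (vtx (rep e)))
    to-base (inj₂ (inj₂ f)) = ≡.refl ◅ to-base (inj₁ (vtx ε))

    connected : ∀ a b → Star (Inc poly) a b
    connected a b = to-base a ◅◅ reverse (λ {a} {b} → Inc-sym a b) (to-base b)

    vertex-connected : ∀ v → ConnectedOn poly (Inc poly (Vx v))
    vertex-connected v a b Na Nb with to-face a Na | to-face b Nb
      where
      N = Inc poly (Vx v)
      to-face : ∀ a → N a → ∃ λ g → vtx g ≡ v × Star (Induced poly N) a (Fc (fac g))
      to-face (inj₂ (inj₁ e)) Na with VE-dart Na
      ... | g , vg , eg = g , vg , (Na , ≡.refl , EF-edge g ≡.refl eg) ◅ ⋆ε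
      to-face (inj₂ (inj₂ f)) Na = dart v f , vtx-dart v f ,
        ≡.subst (λ f′ → Star (Induced poly N) (Fc f) (Fc f′)) (≡.sym (fac-dart v f)) ⋆ε
    ... | g , vg , a→g | h , vh , b→h with vtx-coset (≡.trans vg (≡.sym vh))
    ...   | k , h≈ = a→g ◅◅ walk k g vg
                     ◅◅ ≡.subst (λ f → Star (Induced poly N) (Fc f) b) (fac-cong h≈)
                          (reverse (Induced-sym {N}) b→h)
      where
      N = Inc poly (Vx v)
      -- Rotation about the vertex: the edge of `g ∙ y` separates the faces of `g` and `g ∙ y`.
      walk : ∀ k g → vtx g ≡ v → Star (Induced poly N) (Fc (fac g)) (Fc (fac (g ∙ pow k y)))
      walk zero    g vg = ≡.subst (λ f → Star (Induced poly N) (Fc (fac g)) (Fc f)) (fac-cong (sym (identityʳ g))) ⋆ε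
      walk (suc k) g vg =
        _◅_ {j = Ed (edge (g ∙ y))} (≡.refl , mid , EF-second g) (
        (mid , ≡.refl , EF-first (g ∙ y)) ◅
        ≡.subst (λ f → Star (Induced poly N) (Fc (fac (g ∙ y))) (Fc f)) (fac-cong (assoc g y _))
          (walk k (g ∙ y) (≡.trans (vtx-y g) vg)))
        where
        mid : N (Ed (edge (g ∙ y)))
        mid = VE-edge (g ∙ y) (≡.trans (vtx-y g) vg) ≡.refl

    face-connected : ∀ f → ConnectedOn poly (Inc poly (Fc f))
    face-connected f a b Na Nb with to-vertex a Na | to-vertex b Nb
      where
      N = Inc poly (Fc f)
      to-vertex : ∀ a → N a → ∃ λ g → fac g ≡ f × Star (Induced poly N) a (Vx (vtx g))
      to-vertex (inj₂ (inj₁ e)) Na with EF-dart Na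
      ... | g , fg , eg = g , fg , (Na , ≡.refl , VE-edge g ≡.refl eg) ◅ ⋆ε
      to-vertex (inj₁ v) Na = dart v f , fac-dart v f ,
        ≡.subst (λ v′ → Star (Induced poly N) (Vx v) (Vx v′)) (≡.sym (vtx-dart v f)) ⋆ε
    ... | g , fg , a→g | h , fh , b→h with fac-coset (≡.trans fg (≡.sym fh))
    ...   | k , h≈ = a→g ◅◅ walk k g fg
                     ◅◅ ≡.subst (λ v → Star (Induced poly N) (Vx v) b) (vtx-cong h≈)
                          (reverse (Induced-sym {N}) b→h)
      where
      N = Inc poly (Fc f)
      -- Rotation around the face: the edge of `g` joins the vertices of `g` and `g ∙ x`.
      walk : ∀ k g → fac g ≡ f → Star (Induced poly N) (Vx (vtx g)) (Vx (vtx (g ∙ pow k x)))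
      walk zero    g fg = ≡.subst (λ v → Star (Induced poly N) (Vx (vtx g)) (Vx v)) (vtx-cong (sym (identityʳ g))) ⋆ε
      walk (suc k) g fg =
        _◅_ {j = Ed (edge g)} (≡.refl , mid , VE-first g) (
        (mid , ≡.refl , VE-edge (g ∙ τ) (vtx-τ g) (edge-τ g)) ◅
        ≡.subst (λ v → Star (Induced poly N) (Vx (vtx (g ∙ x))) (Vx v)) (vtx-cong (assoc g x _))
          (walk k (g ∙ x) (≡.trans (fac-x g) fg)))
        where
        mid : N (Ed (edge g))
        mid = EF-edge g fg ≡.refl

    isPolyhedron : IsPolyhedron poly
    isPolyhedron = record
      { trans-VEF         = λ _ _ _ _ _ → ≡.refl
      ; edge-two-vertices = edge-two-vertices
      ; edge-two-faces    = edge-two-faces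
      ; diamond           = λ v f _ → diamond v f
      ; connected         = connected
      ; vertex-connected  = vertex-connected
      ; face-connected    = face-connected
      }

    -- Flags and automorphisms

    -- `dart v (fac ε)` is just some representative of the coset `v`; `translate-vtx` shows that the
    -- choice is immaterial.
    translateV : Carrier → Fin p → Fin p
    translateV k v = vtx (k ∙ dart v (fac ε))

    translateE : Carrier → Fin nE → Fin nE
    translateE k e = edge (k ∙ rep e)

    translateF : Carrier → Fin q → Fin q
    translateF k f = fac (k ∙ dart (vtx ε) f)

    translate-vtx : ∀ k g → translateV k (vtx g) ≡ vtx (k ∙ g)
    translate-vtx k g = vtx-∙ˡ k (vtx-dart _ _)

    translate-edge : ∀ k g → translateE k (edge g) ≡ edge (k ∙ g)
    translate-edge k g = edge-∙ˡ k (edge-rep _)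

    translate-fac : ∀ k g → translateF k (fac g) ≡ fac (k ∙ g)
    translate-fac k g = fac-∙ˡ k (fac-dart _ _)

    private
      undo : ∀ {k l} → k ∙ l ≈ ε → ∀ g → k ∙ (l ∙ g) ≈ g
      undo {k} {l} kl≈ε g = trans (sym (assoc k l g)) (trans (∙-congʳ kl≈ε) (identityˡ g))

    translateV-inverse : ∀ {k l} → k ∙ l ≈ ε → ∀ v → translateV k (translateV l v) ≡ v
    translateV-inverse kl≈ε v =
      ≡.trans (translate-vtx _ _) (≡.trans (vtx-cong (undo kl≈ε _)) (vtx-dart v _))

    translateE-inverse : ∀ {k l} → k ∙ l ≈ ε → ∀ e → translateE k (translateE l e) ≡ e
    translateE-inverse kl≈ε e =
      ≡.trans (translate-edge _ _) (≡.trans (edge-cong (undo kl≈ε _)) (edge-rep e))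

    translateF-inverse : ∀ {k l} → k ∙ l ≈ ε → ∀ f → translateF k (translateF l f) ≡ f
    translateF-inverse kl≈ε f =
      ≡.trans (translate-fac _ _) (≡.trans (fac-cong (undo kl≈ε _)) (fac-dart _ f))

    translate-VE : ∀ k {v e} → VE v e ≡ true → VE (translateV k v) (translateE k e) ≡ true
    translate-VE k ve with VE-dart ve
    ... | g , ≡.refl , ≡.refl = VE-edge (k ∙ g) (≡.sym (translate-vtx k g)) (≡.sym (translate-edge k g))

    translate-EF : ∀ k {e f} → EF e f ≡ true → EF (translateE k e) (translateF k f) ≡ true
    translate-EF k ef with EF-dart ef
    ... | g , ≡.refl , ≡.refl = EF-edge (k ∙ g) (≡.sym (translate-fac k g)) (≡.sym (translate-edge k g))

    translate : Carrier → Automorphism poly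
    translate k = record
      { αV = mk↔ₛ′ (translateV k) (translateV (k ⁻¹)) (translateV-inverse (inverseʳ k)) (translateV-inverse (inverseˡ k))
      ; αE = mk↔ₛ′ (translateE k) (translateE (k ⁻¹)) (translateE-inverse (inverseʳ k)) (translateE-inverse (inverseˡ k))
      ; αF = mk↔ₛ′ (translateF k) (translateF (k ⁻¹)) (translateF-inverse (inverseʳ k)) (translateF-inverse (inverseˡ k))
      ; pres-VE = λ v e → bool-ext
          (λ ve → ≡.subst₂ (λ v e → VE v e ≡ true) (translateV-inverse (inverseˡ k) v) (translateE-inverse (inverseˡ k) e)
                    (translate-VE (k ⁻¹) ve))
          (translate-VE k)
      ; pres-EF = λ e f → bool-ext
          (λ ef → ≡.subst₂ (λ e f → EF e f ≡ true) (translateE-inverse (inverseˡ k) e) (translateF-inverse (inverseˡ k) f)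
                    (translate-EF (k ⁻¹) ef))
          (translate-EF k)
      ; pres-VF = λ _ _ → ≡.refl
      }

    open Flag

    corner : Flag poly → Carrier
    corner Φ = dart (fv Φ) (ff Φ)

    vtx-corner : ∀ Φ → vtx (corner Φ) ≡ fv Φ
    vtx-corner Φ = vtx-dart _ _

    fac-corner : ∀ Φ → fac (corner Φ) ≡ ff Φ
    fac-corner Φ = fac-dart _ _

    colour : Flag poly → Bool
    colour Φ = does (edge (corner Φ) ≟ fe Φ)

    edge-of-flag : ∀ Φ b → colour Φ ≡ b → edge (if b then corner Φ else corner Φ ∙ y) ≡ fe Φ
    edge-of-flag Φ true  c = true-dec c
    edge-of-flag Φ false c with corner-edges (corner Φ)
        (≡.subst (λ v → VE v (fe Φ) ≡ true) (≡.sym (vtx-corner Φ)) (ve Φ))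
        (≡.subst (λ f → EF (fe Φ) f ≡ true) (≡.sym (fac-corner Φ)) (ef Φ))
    ... | inj₂ eq = eq
    ... | inj₁ eq with () ← ≡.trans (≡.sym (dec-true (edge (corner Φ) ≟ fe Φ) eq)) c

    -- Two flags of one colour that share an edge either have the same corner or come from opposite
    -- darts of that edge, and then they differ both in vertex and in face; neither fits adjacency
    -- of rank 0 or 2. For rank 1, corner and colour determine the edge.
    adjacent-colour : ∀ i Φ Ψ → Adj poly i Φ Ψ → colour Φ ≢ colour Ψ
    adjacent-colour i Φ Ψ adj eq with colour Ψ in cΨ
    adjacent-colour zero Φ Ψ (v≢ , e≡ , f≡) cΦ | true
      with edge-coset (≡.trans (edge-of-flag Φ _ cΦ) (≡.trans e≡ (≡.sym (edge-of-flag Ψ _ cΨ))))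
    ... | inj₁ same = v≢ (≡.trans (≡.sym (vtx-corner Φ)) (≡.trans (vtx-cong (sym same)) (vtx-corner Ψ)))
    ... | inj₂ opp  = fac-τ≢ _ (≡.trans (fac-cong (sym opp))
                        (≡.trans (fac-corner Ψ) (≡.trans (≡.sym f≡) (≡.sym (fac-corner Φ)))))
    adjacent-colour zero Φ Ψ (v≢ , e≡ , f≡) cΦ | false
      with edge-coset (≡.trans (edge-of-flag Φ _ cΦ) (≡.trans e≡ (≡.sym (edge-of-flag Ψ _ cΨ))))
    ... | inj₁ same = v≢ (≡.trans (≡.sym (vtx-corner Φ))
                        (≡.trans (vtx-cong (sym (∙-cancelʳ y _ _ same))) (vtx-corner Ψ)))
    ... | inj₂ opp  = fac-y≢ (corner Ψ) (≡.trans (fac-cong opp) (≡.trans (fac-yτ (corner Φ))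
                        (≡.trans (fac-corner Φ) (≡.trans f≡ (≡.sym (fac-corner Ψ))))))
    adjacent-colour (suc zero) Φ Ψ (v≡ , e≢ , f≡) cΦ | true =
      e≢ (≡.trans (≡.sym (edge-of-flag Φ _ cΦ)) (≡.trans (cong edge (cong₂ dart v≡ f≡)) (edge-of-flag Ψ _ cΨ)))
    adjacent-colour (suc zero) Φ Ψ (v≡ , e≢ , f≡) cΦ | false =
      e≢ (≡.trans (≡.sym (edge-of-flag Φ _ cΦ))
           (≡.trans (cong (λ g → edge (g ∙ y)) (cong₂ dart v≡ f≡)) (edge-of-flag Ψ _ cΨ)))
    adjacent-colour (suc (suc zero)) Φ Ψ (v≡ , e≡ , f≢) cΦ | true
      with edge-coset (≡.trans (edge-of-flag Φ _ cΦ) (≡.trans e≡ (≡.sym (edge-of-flag Ψ _ cΨ))))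
    ... | inj₁ same = f≢ (≡.trans (≡.sym (fac-corner Φ)) (≡.trans (fac-cong (sym same)) (fac-corner Ψ)))
    ... | inj₂ opp  = vtx-τ≢ _ (≡.trans (vtx-cong (sym opp))
                        (≡.trans (vtx-corner Ψ) (≡.trans (≡.sym v≡) (≡.sym (vtx-corner Φ)))))
    adjacent-colour (suc (suc zero)) Φ Ψ (v≡ , e≡ , f≢) cΦ | false
      with edge-coset (≡.trans (edge-of-flag Φ _ cΦ) (≡.trans e≡ (≡.sym (edge-of-flag Ψ _ cΨ))))
    ... | inj₁ same = f≢ (≡.trans (≡.sym (fac-corner Φ))
                        (≡.trans (fac-cong (sym (∙-cancelʳ y _ _ same))) (fac-corner Ψ)))
    ... | inj₂ opp  = vtx-τ≢ (corner Φ ∙ y) (≡.trans (vtx-cong (sym opp)) (≡.trans (vtx-y (corner Ψ))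
                        (≡.trans (vtx-corner Ψ) (≡.trans (≡.sym v≡)
                          (≡.trans (≡.sym (vtx-corner Φ)) (≡.sym (vtx-y (corner Φ))))))))

    transitive-on-colour : ∀ b → FlagTransitiveOn poly (λ Φ → colour Φ ≡ b)
    transitive-on-colour b Φ Ψ cΦ cΨ = translate k ,
        ≡.trans (cong (translateV k) (≡.sym (vtx-corner Φ))) (≡.trans (translate-vtx k _)
          (≡.trans (vtx-cong kg≈h) (vtx-corner Ψ))) ,
        ≡.trans (cong (translateE k) (≡.sym (edge-of-flag Φ b cΦ))) (≡.trans (translate-edge k _)
          (≡.trans (edge-cong (moved b)) (edge-of-flag Ψ b cΨ))) ,
        ≡.trans (cong (translateF k) (≡.sym (fac-corner Φ))) (≡.trans (translate-fac k _)
          (≡.trans (fac-cong kg≈h) (fac-corner Ψ)))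
      where
      g = corner Φ
      h = corner Ψ
      k = h ∙ g ⁻¹
      kg≈h : k ∙ g ≈ h
      kg≈h = //-rightDividesˡ g h
      moved : ∀ b → k ∙ (if b then g else g ∙ y) ≈ (if b then h else h ∙ y)
      moved true  = kg≈h
      moved false = trans (sym (assoc k g y)) (∙-congʳ kg≈h)

    -- An automorphism that exchanges the two flags at one corner does so at every corner.
    module Reflection (α : Automorphism poly) where
      open Automorphism α

      private
        v′ : Fin p → Fin p
        v′ = Inverse.to αV
        e′ : Fin nE → Fin nE
        e′ = Inverse.to αE
        f′ : Fin q → Fin q
        f′ = Inverse.to αF

      ↔-injective : ∀ {n} (β : Fin n ↔ Fin n) {i j} → Inverse.to β i ≡ Inverse.to β j → i ≡ j
      ↔-injective β {i} {j} eq = ≡.trans (≡.sym (Inverse.strictlyInverseʳ β i))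
        (≡.trans (cong (Inverse.from β) eq) (Inverse.strictlyInverseʳ β j))

      -- Corners are group elements, so the action of `α` on corners is a map of the group.
      φ : Carrier → Carrier
      φ g = dart (v′ (vtx g)) (f′ (fac g))

      vtx-φ : ∀ g → vtx (φ g) ≡ v′ (vtx g)
      vtx-φ g = vtx-dart _ _

      fac-φ : ∀ g → fac (φ g) ≡ f′ (fac g)
      fac-φ g = fac-dart _ _

      φ-cong : ∀ {g h} → g ≈ h → φ g ≡ φ h
      φ-cong g≈h = cong₂ dart (cong v′ (vtx-cong g≈h)) (cong f′ (fac-cong g≈h))

      Reflected : Carrier → Set
      Reflected g = e′ (edge g) ≡ edge (φ g ∙ y)

      Reflected-cong : ∀ {g h} → g ≈ h → Reflected g → Reflected h
      Reflected-cong g≈h = ≡.subst₂ (λ e d → e′ e ≡ edge (d ∙ y)) (edge-cong g≈h) (φ-cong g≈h)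

      image-edges : ∀ g {e} → VE (vtx g) e ≡ true → EF e (fac g) ≡ true →
        edge (φ g) ≡ e′ e ⊎ edge (φ g ∙ y) ≡ e′ e
      image-edges g {e} ve ef = corner-edges (φ g)
        (≡.subst (λ v → VE v (e′ e) ≡ true) (≡.sym (vtx-φ g)) (≡.trans (pres-VE _ _) ve))
        (≡.subst (λ f → EF (e′ e) f ≡ true) (≡.sym (fac-φ g)) (≡.trans (pres-EF _ _) ef))

      module _ {g : Carrier} (refl-g : Reflected g) where

        second-edge : e′ (edge (g ∙ y)) ≡ edge (φ g)
        second-edge with image-edges g (VE-second g) (EF-second g)
        ... | inj₁ eq = ≡.sym eq
        ... | inj₂ eq = ⊥-elim (edge-y≢ g (↔-injective αE (≡.trans refl-g eq)))

        -- The edge of `g ∙ y` separates the faces of `g` and `g ∙ y`. Its image is the edge of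
        -- `φ g`, whose second face is that of `φ g ∙ y⁻¹`.
        φ-y : φ (g ∙ y) ≈ φ g ∙ y ⁻¹
        φ-y = vtx-fac-injective
          (≡.trans (vtx-φ _) (≡.trans (cong v′ (vtx-y g)) (≡.trans (≡.sym (vtx-φ g)) (≡.sym (vtx-y⁻¹ (φ g))))))
          (≡.trans (fac-φ _) (≡.trans other-face (fac-τ (φ g))))
          where
          other-face : f′ (fac (g ∙ y)) ≡ fac (φ g ∙ τ)
          other-face with edge-faces (φ g) (≡.subst (λ e → EF e (f′ (fac (g ∙ y))) ≡ true) second-edge
                            (≡.trans (pres-EF _ _) (EF-first (g ∙ y))))
          ... | inj₂ eq = ≡.sym eq
          ... | inj₁ eq = ⊥-elim (fac-y≢ g (↔-injective αF (≡.trans (≡.sym eq) (fac-φ g))))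

        Reflected-y : Reflected (g ∙ y)
        Reflected-y = ≡.trans second-edge (edge-cong (sym (trans (∙-congʳ φ-y) (//-rightDividesˡ y (φ g)))))

        -- The edge of `g` joins the vertices of `g` and `g ∙ x`. Its image is the edge of
        -- `φ g ∙ y`, whose other end is the vertex of `φ g ∙ x⁻¹`.
        φ-x : φ (g ∙ x) ≈ φ g ∙ x ⁻¹
        φ-x = vtx-fac-injective
          (≡.trans (vtx-φ _) (≡.trans other-vertex (vtx-cong (gyτ≈gx⁻¹ (φ g)))))
          (≡.trans (fac-φ _) (≡.trans (cong f′ (fac-x g)) (≡.trans (≡.sym (fac-φ g)) (≡.sym (fac-x⁻¹ (φ g))))))
          where
          other-vertex : v′ (vtx (g ∙ x)) ≡ vtx (φ g ∙ y ∙ τ)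
          other-vertex with edge-vertices (φ g ∙ y) (≡.subst (λ e → VE (v′ (vtx (g ∙ x))) e ≡ true) refl-g
                              (≡.trans (pres-VE _ _) (VE-edge (g ∙ τ) (vtx-τ g) (edge-τ g))))
          ... | inj₂ eq = ≡.sym eq
          ... | inj₁ eq = ⊥-elim (vtx-x≢ g (↔-injective αV
                            (≡.trans (≡.sym eq) (≡.trans (vtx-y (φ g)) (vtx-φ g)))))

        Reflected-x : Reflected (g ∙ x)
        Reflected-x with image-edges (g ∙ x) (VE-first (g ∙ x)) (EF-first (g ∙ x))
        ... | inj₂ eq = ≡.sym eq
        ... | inj₁ eq = ⊥-elim (edge-y≢ (g ∙ x) (↔-injective αE (≡.trans (≡.sym eq) (≡.trans first
                (cong e′ (≡.trans (≡.sym (edge-τ g)) (edge-cong (sym (assoc g x y)))))))))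
          where
          first : edge (φ (g ∙ x)) ≡ e′ (edge g)
          first = ≡.trans (edge-cong (trans φ-x (sym (gyτ≈gx⁻¹ (φ g)))))
                    (≡.trans (edge-τ (φ g ∙ y)) (≡.sym refl-g))

      Reflected-pow-y : ∀ k {g} → Reflected g → Reflected (g ∙ pow k y)
      Reflected-pow-y zero    r = Reflected-cong (sym (identityʳ _)) r
      Reflected-pow-y (suc k) r = Reflected-cong (assoc _ y _) (Reflected-pow-y k (Reflected-y r))

      Reflected-pow-x : ∀ k {g} → Reflected g → Reflected (g ∙ pow k x)
      Reflected-pow-x zero    r = Reflected-cong (sym (identityʳ _)) r
      Reflected-pow-x (suc k) r = Reflected-cong (assoc _ x _) (Reflected-pow-x k (Reflected-x r))

      Reflected-all : Reflected ε → ∀ g → Reflected g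
      -- The element with the vertex of `ε` and the face of `g` is a power of `y`; a power of `x`
      -- then leads from it to `g`.
      Reflected-all r g with vtx-coset {ε} (≡.sym (vtx-dart (vtx ε) (fac g))) | fac-coset (fac-dart (vtx ε) (fac g))
      ... | k , d≈ | l , g≈ = Reflected-cong (sym g≈) (Reflected-pow-x l (Reflected-cong (sym d≈) (Reflected-pow-y k r)))

    chiral : IsChiral T → Chiral poly
    chiral no-reflection = colour , adjacent-colour , transitive-on-colour , not-transitive
      where
      Φ₀ Ψ₀ : Flag poly
      Φ₀ = flag (vtx ε) (edge ε) (fac ε) (VE-first ε) (EF-first ε)
      Ψ₀ = flag (vtx ε) (edge (ε ∙ y)) (fac ε) (VE-second ε) (EF-second ε)
      not-transitive : ¬ FlagTransitiveOn poly (λ _ → ⊤)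
      not-transitive tr with tr Φ₀ Ψ₀ tt tt
      ... | α , v≡ , e≡ , f≡ = no-reflection φ (λ g≈h → reflexive (φ-cong g≈h)) (λ g → φ-x (all g)) (λ g → φ-y (all g))
        where
        open Reflection α
        all : ∀ g → Reflected g
        all = Reflected-all (≡.trans e≡ (edge-cong (∙-congʳ (vtx-fac-injective
                (≡.sym (≡.trans (vtx-φ ε) v≡)) (≡.sym (≡.trans (fac-φ ε) f≡))))))

  dual : ∀ {p q} → TightRotary p q → TightRotary q p
  dual T = record
    { group = group
    ; x = y
    ; y = x
    ; τ-involutive = begin
        (y ∙ x) ∙ (y ∙ x)  ≈⟨ assoc y x (y ∙ x) ⟩
        y ∙ (x ∙ (y ∙ x))  ≈⟨ ∙-congˡ (assoc x y x) ⟨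
        y ∙ (τ ∙ x)        ≈⟨ ∙-congˡ τx≈y⁻¹ ⟩
        y ∙ y ⁻¹           ≈⟨ inverseʳ y ⟩
        ε                  ∎
    ; x≉ε = y≉ε
    ; y≉ε = x≉ε
    ; vtx = fac
    ; fac = vtx
    ; vtx-cong = fac-cong
    ; fac-cong = vtx-cong
    ; vtx-y = fac-x
    ; fac-x = vtx-y
    ; vtx-coset = fac-coset
    ; fac-coset = vtx-coset
    ; vtx-fac-injective = λ f≡ v≡ → vtx-fac-injective v≡ f≡
    ; dart = λ f v → dart v f
    ; vtx-dart = λ f v → fac-dart v f
    ; fac-dart = λ f v → vtx-dart v f
    ; nE = nE
    -- Right multiplication by `y` turns left cosets of ⟨yx⟩ into left cosets of ⟨xy⟩.
    ; edge = λ g → edge (g ∙ y)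
    ; edge-cong = λ g≈h → edge-cong (∙-congʳ g≈h)
    ; edge-τ = λ g → ≡.trans (edge-cong (gyxy≈gyτ g)) (edge-τ (g ∙ y))
    ; edge-coset = λ {g} {h} eq → Data.Sum.map (∙-cancelʳ y h g)
        (λ hy≈ → ∙-cancelʳ y _ _ (trans hy≈ (sym (gyxy≈gyτ g)))) (edge-coset eq)
    ; rep = λ e → rep e ∙ y ⁻¹
    ; edge-rep = λ e → ≡.trans (edge-cong (//-rightDividesˡ y (rep e))) (edge-rep e)
    }
    where
    open TightRotary T
    open Polyhedron T using (τx≈y⁻¹)
    open GroupProperties group
    open SetoidReasoning setoid
    gyxy≈gyτ : ∀ g → g ∙ (y ∙ x) ∙ y ≈ g ∙ y ∙ τ
    gyxy≈gyτ g = trans (∙-congʳ (sym (assoc g y x))) (assoc (g ∙ y) x y)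

  dual-chiral : ∀ {p q} (T : TightRotary p q) → IsChiral T → IsChiral (dual T)
  dual-chiral T no-reflection φ φ-cong φ-y φ-x = no-reflection φ φ-cong φ-x φ-y

-- Adjoining `x`, a square root of `w`, to the subgroup of index 2.

module Extension where

  open Rotary
  open import Algebra.Bundles using (Group)
  import Algebra.Properties.Group as GroupProperties
  import Algebra.Properties.Monoid.Mult as Mult
  import Relation.Binary.Reasoning.Setoid as SetoidReasoning
  open import Data.Bool using (Bool; true; false)
  open import Data.Fin using (Fin; zero; suc; combine; remQuot)
  open import Data.Fin.Properties using (combine-injective; combine-remQuot)
  open import Data.Nat using (ℕ; zero; suc; _+_; _*_)
  open import Data.Product using (∃; _×_; _,_; proj₁; proj₂)
  open import Data.Sum using (_⊎_; inj₁; inj₂)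
  open import Level using (0ℓ)
  open import Relation.Nullary using (¬_)
  open import Relation.Binary.PropositionalEquality as ≡ using (_≡_; cong; cong₂)

  module _ (G : Group 0ℓ 0ℓ) where
    open Group G
    open Mult monoid using (×-homo-+) renaming (_×_ to pow)
    open GroupProperties G

    pow-inverse : ∀ {x} → (∃ λ j → pow j x ≈ x ⁻¹) → ∀ l → ∃ λ j → pow j x ≈ pow l x ⁻¹
    pow-inverse         _            zero    = 0 , sym ε⁻¹≈ε
    pow-inverse {x} inv@(j , j≈) (suc l) with pow-inverse inv l
    ... | i , i≈ = i + j , trans (×-homo-+ x i j) (trans (∙-cong i≈ j≈) (sym (⁻¹-anti-homo-∙ x _)))

    coset-of-pow : ∀ {x} → (∃ λ j → pow j x ≈ x ⁻¹) → ∀ {g h} l k → h ∙ pow l x ≈ g ∙ pow k x →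
      ∃ λ i → h ≈ g ∙ pow i x
    coset-of-pow {x} inv {g} {h} l k eq with pow-inverse inv l
    ... | j , j≈ = k + j , trans (sym (//-rightDividesʳ (pow l x) h)) (trans (∙-cong eq (sym j≈))
      (trans (assoc g _ _) (∙-congˡ (sym (×-homo-+ x k j)))))

  -- The subgroup of index 2 generated by w = x ∙ x and y, with η n = x ⁻¹ ∙ n ∙ x.
  record HalfRotary (R S : ℕ) : Set₁ where
    field
      group : Group 0ℓ 0ℓ
    open Group group public
    open Mult monoid public using () renaming (_×_ to pow)
    field
      w y : Carrier
      y≉ε : ¬ y ≈ ε
      pow-w : pow R w ≈ ε
      pow-y : pow S y ≈ ε
      η : Carrier → Carrier
      η-cong : ∀ {g h} → g ≈ h → η g ≈ η h
      η-homo : ∀ g h → η (g ∙ h) ≈ η g ∙ η h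
      η-w : η w ≈ w
      -- From (xy)² = 1: x⁻¹yx = x⁻²y⁻¹. The next law says that conjugating twice by `x` is
      -- conjugating by `w`.
      η-y : η y ≈ w ⁻¹ ∙ y ⁻¹
      η-η : ∀ g → w ∙ η (η g) ≈ g ∙ w
      vtx : Carrier → Fin R
      fac : Carrier → Fin S
      vtx-cong : ∀ {g h} → g ≈ h → vtx g ≡ vtx h
      fac-cong : ∀ {g h} → g ≈ h → fac g ≡ fac h
      vtx-y : ∀ g → vtx (g ∙ y) ≡ vtx g
      fac-w : ∀ g → fac (g ∙ w) ≡ fac g
      vtx-coset : ∀ {g h} → vtx g ≡ vtx h → ∃ λ k → h ≈ g ∙ pow k y
      fac-coset : ∀ {g h} → fac g ≡ fac h → ∃ λ k → h ≈ g ∙ pow k w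
      vtx-fac-injective : ∀ {g h} → vtx g ≡ vtx h → fac g ≡ fac h → g ≈ h
      dart : Fin R → Fin S → Carrier
      vtx-dart : ∀ v f → vtx (dart v f) ≡ v
      fac-dart : ∀ v f → fac (dart v f) ≡ f

    -- Equating this word with b^j a^i expresses a commutator of powers as a power of `bab`. The
    -- exponents stay free so that the relation can be made trivial in a second direct factor.
    word : ℕ → ℕ → ℕ → Carrier → Carrier → Carrier
    word i j k a b = pow i a ∙ (pow j b ∙ pow k (b ∙ (a ∙ b)))

    record Irreflexible : Set where
      field
        i j k : ℕ
        relation    : word i j k w y ≈ pow j y ∙ pow i w
        no-relation : ¬ word i j k (w ⁻¹) (y ⁻¹) ≈ pow j (y ⁻¹) ∙ pow i (w ⁻¹)

  module Extend {R S : ℕ} (H : HalfRotary R S) where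
    open HalfRotary H renaming (group to N)
    open GroupProperties N
    open SetoidReasoning setoid

    infixl 7 _·_
    infix 4 _≋_

    -- (b , n) stands for x ^ b ∙ n.
    Ext : Set
    Ext = Bool × Carrier

    record _≋_ (g h : Ext) : Set where
      constructor _,_
      field
        same-coset : proj₁ g ≡ proj₁ h
        same-part  : proj₂ g ≈ proj₂ h

    -- Each `x` is moved to the left by n x = x (η n), and x² is absorbed as `w`.
    _·_ : Ext → Ext → Ext
    (b     , n) · (false , n′) = b , n ∙ n′
    (false , n) · (true  , n′) = true , η n ∙ n′
    (true  , n) · (true  , n′) = false , w ∙ (η n ∙ n′)

    inv : Ext → Ext
    inv (false , n) = false , n ⁻¹
    -- (xn)⁻¹ = x (xnx)⁻¹, and xnx = w (η n).
    inv (true  , n) = true , (w ∙ η n) ⁻¹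

    ·-cong : ∀ {g g′ h h′} → g ≋ g′ → h ≋ h′ → g · h ≋ g′ · h′
    ·-cong {b , _}     {h = false , _} (≡.refl , n≈) (≡.refl , m≈) = ≡.refl , ∙-cong n≈ m≈
    ·-cong {false , _} {h = true , _}  (≡.refl , n≈) (≡.refl , m≈) = ≡.refl , ∙-cong (η-cong n≈) m≈
    ·-cong {true , _}  {h = true , _}  (≡.refl , n≈) (≡.refl , m≈) = ≡.refl , ∙-congˡ (∙-cong (η-cong n≈) m≈)

    η-ε : η ε ≈ ε
    η-ε = identityˡ-unique (η ε) (η ε) (trans (sym (η-homo ε ε)) (η-cong (identityˡ ε)))

    η-⁻¹ : ∀ g → η (g ⁻¹) ≈ η g ⁻¹
    η-⁻¹ g = inverseˡ-unique _ _ (trans (sym (η-homo (g ⁻¹) g)) (trans (η-cong (inverseˡ g)) η-ε))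

    η-wη : ∀ g → η (w ∙ η g) ≈ g ∙ w
    η-wη g = trans (η-homo w (η g)) (trans (∙-congʳ η-w) (η-η g))

    ·-assoc : ∀ g h k → (g · h) · k ≋ g · (h · k)
    ·-assoc (b     , n) (false , m) (false , l) = ≡.refl , assoc n m l
    ·-assoc (false , n) (true  , m) (false , l) = ≡.refl , assoc (η n) m l
    ·-assoc (true  , n) (true  , m) (false , l) = ≡.refl , trans (assoc w _ l) (∙-congˡ (assoc (η n) m l))
    ·-assoc (false , n) (false , m) (true  , l) = ≡.refl , trans (∙-congʳ (η-homo n m)) (assoc (η n) (η m) l)
    ·-assoc (true  , n) (false , m) (true  , l) = ≡.refl , ∙-congˡ (trans (∙-congʳ (η-homo n m)) (assoc (η n) (η m) l))
    ·-assoc (false , n) (true  , m) (true  , l) = ≡.refl , (begin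
      w ∙ (η (η n ∙ m) ∙ l)        ≈⟨ ∙-congˡ (∙-congʳ (η-homo (η n) m)) ⟩
      w ∙ (η (η n) ∙ η m ∙ l)      ≈⟨ ∙-congˡ (assoc (η (η n)) (η m) l) ⟩
      w ∙ (η (η n) ∙ (η m ∙ l))    ≈⟨ assoc w (η (η n)) (η m ∙ l) ⟨
      w ∙ η (η n) ∙ (η m ∙ l)      ≈⟨ ∙-congʳ (η-η n) ⟩
      n ∙ w ∙ (η m ∙ l)            ≈⟨ assoc n w (η m ∙ l) ⟩
      n ∙ (w ∙ (η m ∙ l))          ∎)
    ·-assoc (true  , n) (true  , m) (true  , l) = ≡.refl , (begin
      η (w ∙ (η n ∙ m)) ∙ l        ≈⟨ ∙-congʳ (η-cong (assoc w (η n) m)) ⟨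
      η (w ∙ η n ∙ m) ∙ l          ≈⟨ ∙-congʳ (η-homo (w ∙ η n) m) ⟩
      η (w ∙ η n) ∙ η m ∙ l        ≈⟨ ∙-congʳ (∙-congʳ (η-wη n)) ⟩
      n ∙ w ∙ η m ∙ l              ≈⟨ assoc (n ∙ w) (η m) l ⟩
      n ∙ w ∙ (η m ∙ l)            ≈⟨ assoc n w (η m ∙ l) ⟩
      n ∙ (w ∙ (η m ∙ l))          ∎)

    ·-identityˡ : ∀ g → (false , ε) · g ≋ g
    ·-identityˡ (false , n) = ≡.refl , identityˡ n
    ·-identityˡ (true  , n) = ≡.refl , trans (∙-congʳ η-ε) (identityˡ n)

    ·-identityʳ : ∀ g → g · (false , ε) ≋ g
    ·-identityʳ (b , n) = ≡.refl , identityʳ n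

    ·-inverseʳ : ∀ g → g · inv g ≋ (false , ε)
    ·-inverseʳ (false , n) = ≡.refl , inverseʳ n
    ·-inverseʳ (true  , n) = ≡.refl , trans (sym (assoc w (η n) _)) (inverseʳ (w ∙ η n))

    ·-inverseˡ : ∀ g → inv g · g ≋ (false , ε)
    ·-inverseˡ (false , n) = ≡.refl , inverseˡ n
    ·-inverseˡ (true  , n) = ≡.refl , (begin
      w ∙ (η ((w ∙ η n) ⁻¹) ∙ n)   ≈⟨ ∙-congˡ (∙-congʳ (η-⁻¹ (w ∙ η n))) ⟩
      w ∙ (η (w ∙ η n) ⁻¹ ∙ n)     ≈⟨ ∙-congˡ (∙-congʳ (⁻¹-cong (η-wη n))) ⟩
      w ∙ ((n ∙ w) ⁻¹ ∙ n)         ≈⟨ ∙-congˡ (∙-congʳ (⁻¹-anti-homo-∙ n w)) ⟩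
      w ∙ (w ⁻¹ ∙ n ⁻¹ ∙ n)        ≈⟨ ∙-congˡ (//-rightDividesˡ n (w ⁻¹)) ⟩
      w ∙ w ⁻¹                     ≈⟨ inverseʳ w ⟩
      ε                            ∎)

    inv-cong : ∀ {g h} → g ≋ h → inv g ≋ inv h
    inv-cong {false , _} (≡.refl , n≈) = ≡.refl , ⁻¹-cong n≈
    inv-cong {true , _}  (≡.refl , n≈) = ≡.refl , ⁻¹-cong (∙-congˡ (η-cong n≈))

    G : Group 0ℓ 0ℓ
    G = record
      { Carrier = Ext
      ; _≈_ = _≋_
      ; _∙_ = _·_
      ; ε = false , ε
      ; _⁻¹ = inv
      ; isGroup = record
        { isMonoid = record
          { isSemigroup = record
            { isMagma = record
              { isEquivalence = record
                { refl = ≡.refl , refl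
                ; sym = λ (b≡ , n≈) → ≡.sym b≡ , sym n≈
                ; trans = λ (b≡ , n≈) (b′≡ , n′≈) → ≡.trans b≡ b′≡ , trans n≈ n′≈
                }
              ; ∙-cong = ·-cong
              }
            ; assoc = ·-assoc
            }
          ; identity = ·-identityˡ , ·-identityʳ
          }
        ; inverse = ·-inverseˡ , ·-inverseʳ
        ; ⁻¹-cong = inv-cong
        }
      }

    module G = Group G
    module GP = GroupProperties G
    open Mult G.monoid using (×-congʳ; ×-assocˡ; ×-homo-+) renaming (_×_ to powG)

    xG yG τG : Ext
    xG = true , ε
    yG = false , y
    τG = xG · yG

    powG-even : ∀ k n → powG k (false , n) ≡ (false , pow k n)
    powG-even zero    n = ≡.refl
    powG-even (suc k) n = cong ((false , n) ·_) (powG-even k n)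

    xx≋w : xG · xG ≋ (false , w)
    xx≋w = ≡.refl , trans (∙-congˡ (trans (identityʳ _) η-ε)) (identityʳ w)

    τG-involutive : τG · τG ≋ (false , ε)
    τG-involutive = ≡.refl , (begin
      w ∙ (η (ε ∙ y) ∙ (ε ∙ y))    ≈⟨ ∙-congˡ (∙-cong (η-cong (identityˡ y)) (identityˡ y)) ⟩
      w ∙ (η y ∙ y)                ≈⟨ ∙-congˡ (∙-congʳ η-y) ⟩
      w ∙ (w ⁻¹ ∙ y ⁻¹ ∙ y)        ≈⟨ ∙-congˡ (//-rightDividesˡ y (w ⁻¹)) ⟩
      w ∙ w ⁻¹                     ≈⟨ inverseʳ w ⟩
      ε                            ∎)

    bit : Bool → Fin 2
    bit false = zero
    bit true  = suc zero

    bit-injective : ∀ {b c} → bit b ≡ bit c → b ≡ c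
    bit-injective {false} {false} _ = ≡.refl
    bit-injective {true}  {true}  _ = ≡.refl

    vtxG : Ext → Fin (2 * R)
    vtxG (b , n) = combine (bit b) (vtx n)

    vtxG-injective : ∀ {g h} → vtxG g ≡ vtxG h → proj₁ g ≡ proj₁ h × vtx (proj₂ g) ≡ vtx (proj₂ h)
    vtxG-injective {b , n} {c , m} eq with combine-injective (bit b) (vtx n) (bit c) (vtx m) eq
    ... | b≡ , v≡ = bit-injective b≡ , v≡

    -- ⟨x⟩ meets `N` in ⟨w⟩, so a coset of ⟨x⟩ is named by its elements in `N`; the coset of xn
    -- contains xnx = w (η n).
    facG : Ext → Fin S
    facG (false , n) = fac n
    facG (true  , n) = fac (w ∙ η n)

    facG-cong : ∀ {g h} → g ≋ h → facG g ≡ facG h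
    facG-cong {false , _} (≡.refl , n≈) = fac-cong n≈
    facG-cong {true , _}  (≡.refl , n≈) = fac-cong (∙-congˡ (η-cong n≈))

    facG-x : ∀ g → facG (g · xG) ≡ facG g
    facG-x (false , n) = ≡.trans (fac-cong (trans (∙-congˡ (η-cong (identityʳ _))) (η-η n))) (fac-w n)
    facG-x (true  , n) = fac-cong (∙-congˡ (identityʳ _))

    fac-pow : ∀ g k → fac (g ∙ pow k w) ≡ fac g
    fac-pow g zero    = fac-cong (identityʳ g)
    fac-pow g (suc k) = ≡.trans (fac-cong (sym (assoc g w _))) (≡.trans (fac-pow (g ∙ w) k) (fac-w g))

    η-pow-w : ∀ k → η (pow k w) ≈ pow k w
    η-pow-w zero    = η-ε
    η-pow-w (suc k) = trans (η-homo w _) (∙-cong η-w (η-pow-w k))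

    fac-∙ˡ : ∀ k {g h} → fac g ≡ fac h → fac (k ∙ g) ≡ fac (k ∙ h)
    fac-∙ˡ k {g} eq with fac-coset eq
    ... | j , h≈ = ≡.sym (≡.trans (fac-cong (trans (∙-congˡ h≈) (sym (assoc k g _)))) (fac-pow (k ∙ g) j))

    fac-η : ∀ {g h} → fac g ≡ fac h → fac (η g) ≡ fac (η h)
    fac-η {g} eq with fac-coset eq
    ... | j , h≈ = ≡.sym (≡.trans
      (fac-cong (trans (η-cong h≈) (trans (η-homo g _) (∙-congˡ (η-pow-w j))))) (fac-pow (η g) j))

    -- Since `η` sends `w ∙ η g` to `g ∙ w`, it undoes the map g ↦ w (η g) on cosets of ⟨w⟩.
    fac-wη-injective : ∀ {g h} → fac (w ∙ η g) ≡ fac (w ∙ η h) → fac g ≡ fac h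
    fac-wη-injective {g} {h} eq = ≡.trans (≡.sym (fac-w g)) (≡.trans
      (≡.trans (fac-cong (sym (η-wη g))) (≡.trans (fac-η eq) (fac-cong (η-wη h)))) (fac-w h))

    vtxG-coset : ∀ {g h} → vtxG g ≡ vtxG h → ∃ λ k → h ≋ g · powG k yG
    vtxG-coset {b , n} {c , m} eq with vtxG-injective {b , n} {c , m} eq
    ... | ≡.refl , v≡ with vtx-coset v≡
    ...   | k , m≈ = k , ≡.subst (λ u → (c , m) ≋ (c , n) · u) (≡.sym (powG-even k y)) (≡.refl , m≈)

    flip : Ext → ℕ
    flip (false , _) = 0
    flip (true  , _) = 1

    even-part : Ext → Carrier
    even-part (false , n) = n
    even-part (true  , n) = w ∙ η n

    flip-even : ∀ g → g · powG (flip g) xG ≋ (false , even-part g)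
    flip-even (false , n) = ≡.refl , identityʳ n
    flip-even (true  , n) = ≡.refl , ∙-congˡ (trans (∙-congˡ (identityʳ ε)) (identityʳ (η n)))

    facG-even : ∀ g → facG g ≡ fac (even-part g)
    facG-even (false , _) = ≡.refl
    facG-even (true  , _) = ≡.refl

    powG-x : ∀ k → powG (k * 2) xG ≋ (false , pow k w)
    powG-x k = G.trans (G.sym (×-assocˡ xG k 2)) (G.trans
      (×-congʳ k (G.trans (G.∙-congˡ {xG} (G.identityʳ xG)) xx≋w)) (G.reflexive (powG-even k w)))

    pow-x-inverse : ∃ λ j → powG j xG ≋ inv xG
    pow-x-inverse = by-order R (vtx ε) pow-w
      where
      -- The element of `Fin R` excludes `R = 0`; the inverse of `x` is then its power with exponent
      -- 2R - 1.
      by-order : ∀ R → Fin R → pow R w ≈ ε → ∃ λ j → powG j xG ≋ inv xG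
      by-order (suc R′) _ pow-w = suc (R′ * 2) ,
        GP.inverseʳ-unique xG _ (G.trans (powG-x (suc R′)) (≡.refl , pow-w))

    facG-coset : ∀ {g h} → facG g ≡ facG h → ∃ λ k → h ≋ g · powG k xG
    facG-coset {g} {h} eq with fac-coset (≡.trans (≡.sym (facG-even g)) (≡.trans eq (facG-even h)))
    ... | k , h≈ = coset-of-pow G pow-x-inverse (flip h) (flip g + k * 2) (G.trans (flip-even h)
      (G.trans (≡.refl , h≈) (G.trans (G.∙-cong (G.sym (flip-even g)) (G.sym (powG-x k)))
        (G.trans (G.assoc g _ _) (G.∙-congˡ (G.sym (×-homo-+ xG (flip g) (k * 2))))))))

    vtxG-facG-injective : ∀ {g h} → vtxG g ≡ vtxG h → facG g ≡ facG h → g ≋ h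
    vtxG-facG-injective {b , n} {c , m} v≡ f≡ with vtxG-injective {b , n} {c , m} v≡
    vtxG-facG-injective {false , _} v≡ f≡ | ≡.refl , v′≡ = ≡.refl , vtx-fac-injective v′≡ f≡
    vtxG-facG-injective {true , _}  v≡ f≡ | ≡.refl , v′≡ = ≡.refl , vtx-fac-injective v′≡ (fac-wη-injective f≡)

    dart′ : Fin 2 → Fin R → Fin S → Ext
    dart′ zero       v f = false , dart v f
    -- The face is pulled back through n ↦ w (η n), whose inverse on cosets of ⟨w⟩ is induced by
    -- `η`.
    dart′ (suc zero) v f = true , dart v (fac (η (dart v f)))

    vtxG-dart′ : ∀ b v f → vtxG (dart′ b v f) ≡ combine b v
    vtxG-dart′ zero       v f = cong (combine {2} zero) (vtx-dart v f)
    vtxG-dart′ (suc zero) v f = cong (combine {2} (suc zero)) (vtx-dart v _)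

    facG-dart′ : ∀ b v f → facG (dart′ b v f) ≡ f
    facG-dart′ zero       v f = fac-dart v f
    facG-dart′ (suc zero) v f = ≡.trans (fac-∙ˡ w (fac-η (fac-dart v _)))
      (≡.trans (fac-cong (η-η (dart v f))) (≡.trans (fac-w _) (fac-dart v f)))

    index : Carrier → Fin (R * S)
    index n = combine (vtx n) (fac n)

    index-injective : ∀ {n m} → index n ≡ index m → n ≈ m
    index-injective {n} {m} eq with combine-injective (vtx n) (fac n) (vtx m) (fac m) eq
    ... | v≡ , f≡ = vtx-fac-injective v≡ f≡

    index-cong : ∀ {n m} → n ≈ m → index n ≡ index m
    index-cong n≈m = cong₂ combine (vtx-cong n≈m) (fac-cong n≈m)

    -- As `τG` lies outside `N`, every coset of ⟨τ⟩ has exactly one element in `N`. The factor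
    -- `ε ∙ y` is left unsimplified so that the second clause is literally the component of
    -- `g · τG`.
    edge-part : Ext → Carrier
    edge-part (false , n) = n
    edge-part (true  , n) = w ∙ (η n ∙ (ε ∙ y))

    edge-part-cong : ∀ {g h} → g ≋ h → edge-part g ≈ edge-part h
    edge-part-cong {false , _} (≡.refl , n≈) = n≈
    edge-part-cong {true , _}  (≡.refl , n≈) = ∙-congˡ (∙-congʳ (η-cong n≈))

    edge-part-spec : ∀ g → (false , edge-part g) ≋ g ⊎ (false , edge-part g) ≋ g · τG
    edge-part-spec (false , n) = inj₁ G.refl
    edge-part-spec (true  , n) = inj₂ G.refl

    ·τ·τ : ∀ g → g · τG · τG ≋ g
    ·τ·τ g = G.trans (G.assoc g τG τG) (G.trans (G.∙-congˡ τG-involutive) (G.identityʳ g))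

    edge-part-τ : ∀ g → edge-part (g · τG) ≈ edge-part g
    edge-part-τ (false , n) = _≋_.same-part (·τ·τ (false , n))
    edge-part-τ (true  , n) = refl

    edge-coset : ∀ {g h} → edge-part g ≈ edge-part h → h ≋ g ⊎ h ≋ g · τG
    edge-coset {g} {h} eq with edge-part-spec g | edge-part-spec h
    ... | inj₁ g≋ | inj₁ h≋ = inj₁ (G.trans (G.sym h≋) (G.trans (≡.refl , sym eq) g≋))
    ... | inj₂ g≋ | inj₁ h≋ = inj₂ (G.trans (G.sym h≋) (G.trans (≡.refl , sym eq) g≋))
    ... | inj₁ g≋ | inj₂ h≋ = inj₂ (G.trans (G.sym (·τ·τ h)) (G.∙-congʳ (G.trans (G.sym h≋) (G.trans (≡.refl , sym eq) g≋))))
    ... | inj₂ g≋ | inj₂ h≋ = inj₁ (GP.∙-cancelʳ τG h g (G.trans (G.sym h≋) (G.trans (≡.refl , sym eq) g≋)))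

    extension : TightRotary (2 * R) S
    extension = record
      { group = G
      ; x = xG
      ; y = yG
      ; τ-involutive = τG-involutive
      ; x≉ε = λ ()
      ; y≉ε = λ (_ , y≈ε) → y≉ε y≈ε
      ; vtx = vtxG
      ; fac = facG
      ; vtx-cong = λ { {b , _} (≡.refl , n≈) → cong (combine (bit b)) (vtx-cong n≈) }
      ; fac-cong = facG-cong
      ; vtx-y = λ (b , n) → cong (combine (bit b)) (vtx-y n)
      ; fac-x = facG-x
      ; vtx-coset = λ {g} {h} → vtxG-coset {g} {h}
      ; fac-coset = facG-coset
      ; vtx-fac-injective = λ {g} {h} → vtxG-facG-injective {g} {h}
      ; dart = λ i f → dart′ (proj₁ (remQuot R i)) (proj₂ (remQuot {2} R i)) f
      ; vtx-dart = λ i f → ≡.trans (vtxG-dart′ (proj₁ (remQuot {2} R i)) _ f) (combine-remQuot {2} R i)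
      ; fac-dart = λ i f → facG-dart′ (proj₁ (remQuot {2} R i)) _ f
      ; nE = R * S
      ; edge = λ g → index (edge-part g)
      ; edge-cong = λ g≋h → index-cong (edge-part-cong g≋h)
      ; edge-τ = λ g → index-cong (edge-part-τ g)
      ; edge-coset = λ eq → edge-coset (index-injective eq)
      ; rep = λ e → false , dart (proj₁ (remQuot S e)) (proj₂ (remQuot {R} S e))
      ; edge-rep = λ e → ≡.trans (cong₂ combine (vtx-dart _ _) (fac-dart _ _)) (combine-remQuot {R} S e)
      }

  module _ {R S : ℕ} (H : HalfRotary R S) where
    open HalfRotary H hiding (group)
    open Extend H

    -- A reflection would carry the relation between `w` and `y`, letter by letter, to their
    -- inverses. `Mirror a b` records that reading `a` before `φ` amounts to reading `b` after it.
    extension-chiral : Irreflexible → IsChiral extension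
    extension-chiral irr φ φ-cong φ-x φ-y = no-relation (_≋_.same-part (GP.∙-cancelˡ (φ G.ε)
      (false , word i j k (w ⁻¹) (y ⁻¹)) (false , pow j (y ⁻¹) ∙ pow i (w ⁻¹)) (begin
      φ G.ε · (false , word i j k (w ⁻¹) (y ⁻¹))              ≈⟨ mirror-word G.ε ⟨
      φ (G.ε · (false , word i j k w y))                      ≈⟨ φ-cong (G.∙-congˡ {G.ε} {false , word i j k w y} (≡.refl , relation)) ⟩
      φ (G.ε · (false , pow j y ∙ pow i w))                   ≈⟨ mirror-∙ (mirror-pow j mirror-y) (mirror-pow i mirror-w) G.ε ⟩
      φ G.ε · (false , pow j (y ⁻¹) ∙ pow i (w ⁻¹))           ∎)))
      where
      open Irreflexible irr
      open SetoidReasoning G.setoid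

      Mirror : Carrier → Carrier → Set
      Mirror a b = ∀ g → φ (g · (false , a)) ≋ φ g · (false , b)

      mirror-∙ : ∀ {a b c d} → Mirror a b → Mirror c d → Mirror (a ∙ c) (b ∙ d)
      mirror-∙ {a} {b} {c} {d} ab cd g = G.trans (φ-cong (G.sym (G.assoc g (false , a) (false , c))))
        (G.trans (cd _) (G.trans (G.∙-congʳ {false , d} (ab g)) (G.assoc (φ g) (false , b) (false , d))))

      mirror-pow : ∀ k {a b} → Mirror a b → Mirror (pow k a) (pow k b)
      mirror-pow zero    ab g = G.trans (φ-cong (G.identityʳ g)) (G.sym (G.identityʳ (φ g)))
      mirror-pow (suc k) ab = mirror-∙ ab (mirror-pow k ab)

      mirror-y : Mirror y (y ⁻¹)
      mirror-y = φ-y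

      mirror-w : Mirror w (w ⁻¹)
      mirror-w g = begin
        φ (g · (false , w))        ≈⟨ φ-cong (G.∙-congˡ xx≋w) ⟨
        φ (g · (xG · xG))          ≈⟨ φ-cong (G.assoc g xG xG) ⟨
        φ (g · xG · xG)            ≈⟨ φ-x (g · xG) ⟩
        φ (g · xG) · inv xG        ≈⟨ G.∙-congʳ (φ-x g) ⟩
        φ g · inv xG · inv xG      ≈⟨ G.assoc (φ g) (inv xG) (inv xG) ⟩
        φ g · (inv xG · inv xG)    ≈⟨ G.∙-congˡ (GP.⁻¹-anti-homo-∙ xG xG) ⟨
        φ g · inv (xG · xG)        ≈⟨ G.∙-congˡ (G.⁻¹-cong xx≋w) ⟩
        φ g · (false , w ⁻¹)       ∎

      mirror-word : Mirror (word i j k w y) (word i j k (w ⁻¹) (y ⁻¹))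
      mirror-word = mirror-∙ (mirror-pow i mirror-w) (mirror-∙ (mirror-pow j mirror-y)
        (mirror-pow k (mirror-∙ mirror-y (mirror-∙ mirror-w mirror-y))))

-- Direct products with coprime orders of the generators.

module DirectProducts where

  open Extension
  open import Algebra.Bundles using (Group)
  import Algebra.Construct.DirectProduct as DirectProduct
  import Algebra.Properties.Group as GroupProperties
  import Algebra.Properties.Monoid.Mult as Mult
  import Relation.Binary.Reasoning.Setoid as SetoidReasoning
  open import Data.Fin using (Fin; combine; remQuot)
  open import Data.Fin.Properties using (combine-injective; combine-remQuot)
  open import Data.Nat using (ℕ; zero; suc; _+_; _*_)
  open import Data.Nat.Properties using (*-comm; +-comm; *-zeroʳ)
  open import Data.Nat.Coprimality using (Coprime; coprime-Bézout) renaming (sym to coprime-sym)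
  open import Data.Nat.GCD using (module Bézout)
  open import Data.Product using (∃; _×_; _,_; proj₁; proj₂)
  open import Level using (0ℓ)
  open import Relation.Binary.PropositionalEquality as ≡ using (_≡_; cong; cong₂)

  module _ (G : Group 0ℓ 0ℓ) where
    open Group G
    open Mult monoid using (×-congʳ; ×-congˡ; ×-assocˡ; ×-homo-+) renaming (_×_ to pow)
    open GroupProperties G
    open SetoidReasoning setoid

    pow-ε : ∀ k → pow k ε ≈ ε
    pow-ε zero    = refl
    pow-ε (suc k) = trans (identityˡ _) (pow-ε k)

    pow-multiple : ∀ {a m} → pow m a ≈ ε → ∀ k → pow (k * m) a ≈ ε
    pow-multiple {a} {m} am≈ε k = trans (sym (×-assocˡ a k m)) (trans (×-congʳ k am≈ε) (pow-ε k))

    pow-suc-multiple : ∀ {a m} → pow m a ≈ ε → ∀ k → pow (1 + k * m) a ≈ a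
    pow-suc-multiple am≈ε k = trans (∙-congˡ (pow-multiple am≈ε k)) (identityʳ _)

    -- If c ≡ -1 (mod m), then c * (m - 1) ≡ 1 (mod m).
    pow-negative : ∀ {a} m → pow (suc m) a ≈ ε → ∀ c → pow (1 + c) a ≈ ε → pow (m * c) a ≈ a
    pow-negative {a} m am≈ε c ac≈ε = ∙-cancelˡ (pow c a) _ _ (begin
      pow c a ∙ pow (m * c) a  ≈⟨ ×-homo-+ a c (m * c) ⟨
      pow (suc m * c) a        ≈⟨ ×-congˡ (*-comm (suc m) c) ⟩
      pow (c * suc m) a        ≈⟨ pow-multiple am≈ε c ⟩
      ε                        ≈⟨ ac≈ε ⟨
      pow (1 + c) a            ≈⟨ ×-congˡ (+-comm 1 c) ⟩
      pow (c + 1) a            ≈⟨ ×-homo-+ a c 1 ⟩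
      pow c a ∙ (a ∙ ε)        ≈⟨ ∙-congˡ (identityʳ a) ⟩
      pow c a ∙ a              ∎)

  module _ (G₁ G₂ : Group 0ℓ 0ℓ) where
    private
      module G₁ = Group G₁
      module G₂ = Group G₂
      open Mult G₁.monoid using () renaming (_×_ to pow₁; ×-congˡ to ×-congˡ₁)
      open Mult G₂.monoid using () renaming (_×_ to pow₂)

    -- The Chinese remainder idempotent: 1 modulo `m`, 0 modulo `n`. Bézout over ℕ comes with two
    -- signs: in the second case `y * n` is -1 modulo the first order, and multiplying by that order
    -- minus 1 restores the sign.
    idempotent-exponent : ∀ {a b m n} → Coprime m n → pow₁ m a G₁.≈ G₁.ε → pow₂ n b G₂.≈ G₂.ε →
      ∃ λ e → pow₁ e a G₁.≈ a × pow₂ e b G₂.≈ G₂.ε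
    idempotent-exponent {a} {b} {m} {n} coprime am≈ε bn≈ε with coprime-Bézout coprime
    ... | Bézout.-+ x y 1+xm≡yn = y * n ,
          G₁.trans (×-congˡ₁ (≡.sym 1+xm≡yn)) (pow-suc-multiple G₁ am≈ε x) , pow-multiple G₂ bn≈ε y
    idempotent-exponent {m = zero} _ _ _ | Bézout.+- x y 1+yn≡xm with () ← ≡.trans 1+yn≡xm (*-zeroʳ x)
    idempotent-exponent {a} {b} {suc m} {n} _ am≈ε bn≈ε | Bézout.+- x y 1+yn≡xm = m * (y * n) ,
      pow-negative G₁ m am≈ε (y * n) (G₁.trans (×-congˡ₁ 1+yn≡xm) (pow-multiple G₁ am≈ε x)) ,
      pow-multiple G₂ (pow-multiple G₂ bn≈ε y) m

  module _ (G₁ G₂ : Group 0ℓ 0ℓ) where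
    private
      module G₁ = Group G₁
      module G₂ = Group G₂
      open Mult G₁.monoid using () renaming (_×_ to pow₁; ×-congʳ to ×-congʳ₁; ×-assocˡ to ×-assocˡ₁; ×-homo-+ to ×-homo-+₁)
      open Mult G₂.monoid using () renaming (_×_ to pow₂; ×-congʳ to ×-congʳ₂; ×-assocˡ to ×-assocˡ₂; ×-homo-+ to ×-homo-+₂)

    common-exponent : ∀ {a b m n} → Coprime m n → pow₁ m a G₁.≈ G₁.ε → pow₂ n b G₂.≈ G₂.ε →
      ∀ k l → ∃ λ j → pow₁ j a G₁.≈ pow₁ k a × pow₂ j b G₂.≈ pow₂ l b
    common-exponent {a} {b} coprime am≈ε bn≈ε k l
      with idempotent-exponent G₁ G₂ coprime am≈ε bn≈ε | idempotent-exponent G₂ G₁ (coprime-sym coprime) bn≈ε am≈ε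
    ... | d , ad≈a , bd≈ε | e , be≈b , ae≈ε = k * d + l * e ,
      G₁.trans (×-homo-+₁ a (k * d) (l * e)) (G₁.trans
        (G₁.∙-cong (G₁.trans (G₁.sym (×-assocˡ₁ a k d)) (×-congʳ₁ k ad≈a)) (pow-multiple G₁ ae≈ε l)) (G₁.identityʳ _)) ,
      G₂.trans (×-homo-+₂ b (k * d) (l * e)) (G₂.trans
        (G₂.∙-cong (pow-multiple G₂ bd≈ε k) (G₂.trans (G₂.sym (×-assocˡ₂ b l e)) (×-congʳ₂ l be≈b))) (G₂.identityˡ _))

  module Product {R₁ S₁ R₂ S₂ : ℕ} (H₁ : HalfRotary R₁ S₁) (H₂ : HalfRotary R₂ S₂)
                 (coprime-R : Coprime R₁ R₂) (coprime-S : Coprime S₁ S₂) where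
    private
      module H₁ = HalfRotary H₁
      module H₂ = HalfRotary H₂

    N : Group 0ℓ 0ℓ
    N = DirectProduct.group H₁.group H₂.group

    open Group N
    open Mult monoid using () renaming (_×_ to pow)

    pow-pair : ∀ k a b → pow k (a , b) ≡ (H₁.pow k a , H₂.pow k b)
    pow-pair zero    a b = ≡.refl
    pow-pair (suc k) a b = cong ((a , b) ∙_) (pow-pair k a b)

    pow-pair-ε : ∀ {a b} m n → H₁.pow m a H₁.≈ H₁.ε → H₂.pow n b H₂.≈ H₂.ε → pow (m * n) (a , b) ≈ ε
    pow-pair-ε {a} {b} m n am≈ε bn≈ε = ≡.subst (_≈ ε) (≡.sym (pow-pair (m * n) a b))
      (≡.subst (λ k → H₁.pow k a H₁.≈ H₁.ε) (*-comm n m) (pow-multiple H₁.group am≈ε n) ,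
       pow-multiple H₂.group bn≈ε m)

    vtx : Carrier → Fin (R₁ * R₂)
    vtx (g , h) = combine (H₁.vtx g) (H₂.vtx h)

    fac : Carrier → Fin (S₁ * S₂)
    fac (g , h) = combine (H₁.fac g) (H₂.fac h)

    vtx-injective : ∀ {g h} → vtx g ≡ vtx h → H₁.vtx (proj₁ g) ≡ H₁.vtx (proj₁ h) × H₂.vtx (proj₂ g) ≡ H₂.vtx (proj₂ h)
    vtx-injective = combine-injective _ _ _ _

    fac-injective : ∀ {g h} → fac g ≡ fac h → H₁.fac (proj₁ g) ≡ H₁.fac (proj₁ h) × H₂.fac (proj₂ g) ≡ H₂.fac (proj₂ h)
    fac-injective = combine-injective _ _ _ _

    vtx-coset : ∀ {g h} → vtx g ≡ vtx h → ∃ λ k → h ≈ g ∙ pow k (H₁.y , H₂.y)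
    vtx-coset {g} {h} eq with vtx-injective {g} {h} eq
    ... | eq₁ , eq₂ with H₁.vtx-coset eq₁ | H₂.vtx-coset eq₂
    ...   | k₁ , h₁≈ | k₂ , h₂≈ with common-exponent H₁.group H₂.group coprime-S H₁.pow-y H₂.pow-y k₁ k₂
    ...     | k , k≈k₁ , k≈k₂ = k , ≡.subst (λ u → h ≈ g ∙ u) (≡.sym (pow-pair k _ _))
      (H₁.trans h₁≈ (H₁.∙-congˡ (H₁.sym k≈k₁)) , H₂.trans h₂≈ (H₂.∙-congˡ (H₂.sym k≈k₂)))

    fac-coset : ∀ {g h} → fac g ≡ fac h → ∃ λ k → h ≈ g ∙ pow k (H₁.w , H₂.w)
    fac-coset {g} {h} eq with fac-injective {g} {h} eq
    ... | eq₁ , eq₂ with H₁.fac-coset eq₁ | H₂.fac-coset eq₂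
    ...   | k₁ , h₁≈ | k₂ , h₂≈ with common-exponent H₁.group H₂.group coprime-R H₁.pow-w H₂.pow-w k₁ k₂
    ...     | k , k≈k₁ , k≈k₂ = k , ≡.subst (λ u → h ≈ g ∙ u) (≡.sym (pow-pair k _ _))
      (H₁.trans h₁≈ (H₁.∙-congˡ (H₁.sym k≈k₁)) , H₂.trans h₂≈ (H₂.∙-congˡ (H₂.sym k≈k₂)))

    product : HalfRotary (R₁ * R₂) (S₁ * S₂)
    product = record
      { group = N
      ; w = H₁.w , H₂.w
      ; y = H₁.y , H₂.y
      ; y≉ε = λ (y₁≈ε , _) → H₁.y≉ε y₁≈ε
      ; pow-w = pow-pair-ε R₁ R₂ H₁.pow-w H₂.pow-w
      ; pow-y = pow-pair-ε S₁ S₂ H₁.pow-y H₂.pow-y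
      ; η = λ (g , h) → H₁.η g , H₂.η h
      ; η-cong = λ (g≈ , h≈) → H₁.η-cong g≈ , H₂.η-cong h≈
      ; η-homo = λ (g , h) (g′ , h′) → H₁.η-homo g g′ , H₂.η-homo h h′
      ; η-w = H₁.η-w , H₂.η-w
      ; η-y = H₁.η-y , H₂.η-y
      ; η-η = λ (g , h) → H₁.η-η g , H₂.η-η h
      ; vtx = vtx
      ; fac = fac
      ; vtx-cong = λ (g≈ , h≈) → cong₂ combine (H₁.vtx-cong g≈) (H₂.vtx-cong h≈)
      ; fac-cong = λ (g≈ , h≈) → cong₂ combine (H₁.fac-cong g≈) (H₂.fac-cong h≈)
      ; vtx-y = λ (g , h) → cong₂ combine (H₁.vtx-y g) (H₂.vtx-y h)
      ; fac-w = λ (g , h) → cong₂ combine (H₁.fac-w g) (H₂.fac-w h)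
      ; vtx-coset = λ {g} {h} → vtx-coset {g} {h}
      ; fac-coset = λ {g} {h} → fac-coset {g} {h}
      ; vtx-fac-injective = λ {g} {h} v≡ f≡ →
          H₁.vtx-fac-injective (proj₁ (vtx-injective {g} {h} v≡)) (proj₁ (fac-injective {g} {h} f≡)) ,
          H₂.vtx-fac-injective (proj₂ (vtx-injective {g} {h} v≡)) (proj₂ (fac-injective {g} {h} f≡))
      ; dart = λ v f →
          H₁.dart (proj₁ (remQuot R₂ v)) (proj₁ (remQuot S₂ f)) ,
          H₂.dart (proj₂ (remQuot {R₁} R₂ v)) (proj₂ (remQuot {S₁} S₂ f))
      ; vtx-dart = λ v f → ≡.trans (cong₂ combine (H₁.vtx-dart _ _) (H₂.vtx-dart _ _)) (combine-remQuot {R₁} R₂ v)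
      ; fac-dart = λ v f → ≡.trans (cong₂ combine (H₁.fac-dart _ _) (H₂.fac-dart _ _)) (combine-remQuot {S₁} S₂ f)
      }

    open HalfRotary product using (word; Irreflexible)

    word-pair : ∀ i j k a b c d → word i j k (a , c) (b , d) ≡ (H₁.word i j k a b , H₂.word i j k c d)
    word-pair i j k a b c d = cong₂ _∙_ (pow-pair i a c) (cong₂ _∙_ (pow-pair j b d) (pow-pair k _ _))

    -- The failure for the inverses is already visible in the first factor, so the second one only
    -- has to satisfy the original relation.
    product-irreflexible : (irr : H₁.Irreflexible) → let open HalfRotary.Irreflexible irr in
      H₂.word i j k H₂.w H₂.y H₂.≈ H₂.pow j H₂.y H₂.∙ H₂.pow i H₂.w → Irreflexible
    product-irreflexible irr relation₂ = record
      { i = i ; j = j ; k = k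
      ; relation = ≡.subst₂ _≈_ (≡.sym (word-pair i j k _ _ _ _))
          (≡.sym (cong₂ _∙_ (pow-pair j _ _) (pow-pair i _ _))) (relation , relation₂)
      ; no-relation = λ rel → no-relation (proj₁
          (≡.subst₂ _≈_ (word-pair i j k _ _ _ _) (cong₂ _∙_ (pow-pair j _ _) (pow-pair i _ _)) rel))
      }
      where open HalfRotary.Irreflexible irr

-- Congruences of integers and residues.

module Modular where

  open import Data.Empty using (⊥-elim)
  open import Data.Fin using (Fin; fromℕ<; toℕ)
  open import Data.Fin.Properties using (toℕ-fromℕ<; toℕ<n; toℕ-injective)
  open import Data.Integer using (ℤ; +_; -[1+_]; _+_; _*_; -_; _-_; _/ℕ_; 0ℤ)
  open import Data.Integer.DivMod using (n%ℕd<d; a≡a%ℕn+[a/ℕn]*n)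
  import Data.Integer.Properties as ℤ
  open import Data.Integer.Tactic.RingSolver using (solve-∀)
  open import Data.Nat using (ℕ; zero; suc; NonZero)
  import Data.Nat as ℕ
  import Data.Nat.Properties as ℕ
  open import Relation.Binary.PropositionalEquality

  -- With an integer modulus and an explicit quotient, congruences reduce to polynomial identities,
  -- even for moduli that are products.
  record Cong (n a b : ℤ) : Set where
    constructor by
    field
      quotient : ℤ
      equation : a ≡ b + quotient * n

  module _ {n : ℤ} where

    cong-reflexive : ∀ {a b} → a ≡ b → Cong n a b
    cong-reflexive {a} refl = by 0ℤ (lemma a n)
      where
      lemma : ∀ a n → a ≡ a + 0ℤ * n
      lemma = solve-∀

    cong-sym : ∀ {a b} → Cong n a b → Cong n b a
    cong-sym {_} {b} (by k eq) = by (- k) (trans (lemma b k n) (cong (λ a → a + - k * n) (sym eq)))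
      where
      lemma : ∀ b k n → b ≡ b + k * n + - k * n
      lemma = solve-∀

    cong-trans : ∀ {a b c} → Cong n a b → Cong n b c → Cong n a c
    cong-trans {c = c} (by k refl) (by l refl) = by (l + k) (lemma c k l n)
      where
      lemma : ∀ c k l n → c + l * n + k * n ≡ c + (l + k) * n
      lemma = solve-∀

    cong-+ : ∀ {a b c d} → Cong n a b → Cong n c d → Cong n (a + c) (b + d)
    cong-+ {b = b} {d = d} (by k refl) (by l refl) = by (k + l) (lemma b d k l n)
      where
      lemma : ∀ b d k l n → (b + k * n) + (d + l * n) ≡ (b + d) + (k + l) * n
      lemma = solve-∀

    cong-* : ∀ {a b c d} → Cong n a b → Cong n c d → Cong n (a * c) (b * d)
    cong-* {b = b} {d = d} (by k refl) (by l refl) = by (k * d + l * (b + k * n)) (lemma b d k l n)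
      where
      lemma : ∀ b d k l n → (b + k * n) * (d + l * n) ≡ b * d + (k * d + l * (b + k * n)) * n
      lemma = solve-∀

    cong-*ˡ : ∀ k {a b} → Cong n a b → Cong n (k * a) (k * b)
    cong-*ˡ k = cong-* (cong-reflexive {k} refl)

    cong-neg : ∀ {a b} → Cong n a b → Cong n (- a) (- b)
    cong-neg {b = b} (by k refl) = by (- k) (lemma b k n)
      where
      lemma : ∀ b k n → - (b + k * n) ≡ - b + - k * n
      lemma = solve-∀

    cong-- : ∀ {a b c d} → Cong n a b → Cong n c d → Cong n (a - c) (b - d)
    cong-- p q = cong-+ p (cong-neg q)

  cong-weaken : ∀ {m n a b} k → n ≡ k * m → Cong n a b → Cong m a b
  cong-weaken {m} {b = b} k refl (by l refl) = by (l * k) (lemma b l k m)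
    where
    lemma : ∀ b l k m → b + l * (k * m) ≡ b + l * k * m
    lemma = solve-∀

  -- A positive quotient forces `x` to be at least `n`; a negative one does the same to `y` after
  -- reversing the congruence.
  cong-unique : ∀ {n x y} → x ℕ.< n → y ℕ.< n → Cong (+ n) (+ x) (+ y) → x ≡ y
  cong-unique {n} {x} {y} x<n y<n p@(by k eq) = by-sign k refl
    where
    not-positive : ∀ {x y} k → x ℕ.< n → + x ≢ + y + + suc k * + n
    not-positive {x} {y} k x<n eq = ℕ.<⇒≱ x<n (subst (n ℕ.≤_) (sym x≡)
        (ℕ.≤-trans (ℕ.m≤m+n n (k ℕ.* n)) (ℕ.m≤n+m _ y)))
      where
      x≡ : x ≡ y ℕ.+ suc k ℕ.* n
      x≡ = ℤ.+-injective (trans eq (cong (λ z → + y + z) (sym (ℤ.pos-* (suc k) n))))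
    by-sign : ∀ l → k ≡ l → x ≡ y
    by-sign (+ zero)  refl = ℤ.+-injective (trans eq (ℤ.+-identityʳ (+ y)))
    by-sign (+ suc l) refl = ⊥-elim (not-positive l x<n eq)
    by-sign -[1+ l ]  refl = ⊥-elim (not-positive l y<n (Cong.equation (cong-sym p)))

  module _ (n : ℕ) .{{_ : NonZero n}} where

    residue : ℤ → Fin n
    residue a = fromℕ< (n%ℕd<d a n)

    residue-spec : ∀ a → Cong (+ n) (+ toℕ (residue a)) a
    residue-spec a = cong-sym (by (a /ℕ n)
      (trans (a≡a%ℕn+[a/ℕn]*n a n) (cong (λ r → + r + a /ℕ n * + n) (sym (toℕ-fromℕ< (n%ℕd<d a n))))))

    residue-cong : ∀ {a b} → Cong (+ n) a b → residue a ≡ residue b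
    residue-cong {a} {b} p = toℕ-injective (cong-unique (toℕ<n _) (toℕ<n _)
      (cong-trans (residue-spec a) (cong-trans p (cong-sym (residue-spec b)))))

    residue-injective : ∀ {a b} → residue a ≡ residue b → Cong (+ n) a b
    residue-injective {a} {b} eq = cong-trans (cong-sym (residue-spec a))
      (cong-trans (cong-reflexive (cong (λ i → + toℕ i) eq)) (residue-spec b))

    residue-toℕ : ∀ i → residue (+ toℕ i) ≡ i
    residue-toℕ i = toℕ-injective (cong-unique (toℕ<n _) (toℕ<n i) (residue-spec _))

-- The Heisenberg quotient and its broken mirror symmetry.

module HeisenbergGroup where

  open Extension
  open Modular
  open import Algebra.Bundles using (Group)
  import Algebra.Properties.Monoid.Mult as Mult
  open import Data.Fin using (Fin; toℕ)
  open import Data.Integer using (ℤ; +_; _+_; _*_; -_; _-_; 0ℤ; 1ℤ)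
  import Data.Integer as ℤ
  import Data.Integer.Properties as ℤ
  open import Data.Integer.Tactic.RingSolver using (solve-∀)
  open import Data.Nat using (ℕ; zero; suc; NonZero)
  open import Data.Nat.Divisibility using (_∣_)
  open import Data.Integer.Divisibility.Signed using (divides; ∣⇒∣ᵤ)
  import Data.Nat as ℕ
  import Data.Nat.Properties as ℕ
  open import Data.Product using (∃; _,_)
  open import Level using (0ℓ)
  open import Relation.Nullary using (¬_)
  open import Relation.Binary.PropositionalEquality

  module Heisenberg (m r s t : ℕ) .{{_ : NonZero m}} .{{_ : NonZero r}} .{{_ : NonZero s}}
                    (1<m : 1 ℕ.< m) (sm≡tr : s ℕ.* m ≡ t ℕ.* r) where

    M Z S R : ℤ
    M = + m
    Z = + s * M
    S = Z * M
    R = + r * M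

    nR nS : ℕ
    nR = r ℕ.* m
    nS = s ℕ.* (m ℕ.* m)

    instance
      nR-nonZero : NonZero nR
      nR-nonZero = ℕ.m*n≢0 r m
      mm-nonZero : NonZero (m ℕ.* m)
      mm-nonZero = ℕ.m*n≢0 m m
      nS-nonZero : NonZero nS
      nS-nonZero = ℕ.m*n≢0 s (m ℕ.* m)

    nR≡R : + nR ≡ R
    nR≡R = ℤ.pos-* r m

    nS≡S : + nS ≡ S
    nS≡S = trans (ℤ.pos-* s (m ℕ.* m)) (trans (cong (+ s *_) (ℤ.pos-* m m)) (sym (ℤ.*-assoc (+ s) M M)))

    -- This is `r ∣ sm`: a multiple of `Z` by `M` vanishes for the exponents of `w` too, so `z` has
    -- trivial `m`-th power in both coordinates.
    S≡tR : S ≡ + t * R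
    S≡tR = trans (cong (_* M) (trans (sym (ℤ.pos-* s m)) (trans (cong +_ sm≡tr) (ℤ.pos-* t r)))) (ℤ.*-assoc (+ t) (+ r) M)

    S⇒R : ∀ {a b} → Cong S a b → Cong R a b
    S⇒R = cong-weaken (+ t) S≡tR

    S⇒M : ∀ {a b} → Cong S a b → Cong M a b
    S⇒M = cong-weaken Z refl

    R⇒M : ∀ {a b} → Cong R a b → Cong M a b
    R⇒M = cong-weaken (+ r) refl

    -- As `Z * M` is `S`, an exponent of `z` matters only modulo `m`, and modulo `m` the entries `a`
    -- and `b` are well defined.
    scale : ∀ {a b} → Cong M a b → Cong S (Z * a) (Z * b)
    scale {b = b} (by k refl) = by k (lemma b k Z M)
      where
      lemma : ∀ b k Z M → Z * (b + k * M) ≡ Z * b + k * (Z * M)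
      lemma = solve-∀

    Z-vanishes : ∀ a b → Cong M (a + Z * b) a
    Z-vanishes a b = by (+ s * b) (lemma a b (+ s) M)
      where
      lemma : ∀ a b s M → a + s * M * b ≡ a + s * b * M
      lemma = solve-∀

    -- ⟨ a , b , c ⟩ stands for y ^ a ∙ w ^ b ∙ z ^ (c - a b), where the central element
    -- z = ⟨ 0 , 0 , 1 ⟩ is identified with ⟨ 2 Z , Z , 0 ⟩; eliminating z leaves α and β.
    record Heis : Set where
      constructor ⟨_,_,_⟩
      field
        a b c : ℤ
    open Heis

    α β : Heis → ℤ
    α g = a g + Z * (+ 2 * c g)
    β g = b g + Z * c g

    infix 4 _≈_
    infixl 7 _∙_

    record _≈_ (g h : Heis) : Set where
      constructor _,_
      field
        α≈ : Cong S (α g) (α h)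
        β≈ : Cong R (β g) (β h)
    open _≈_

    _∙_ : Heis → Heis → Heis
    g ∙ h = ⟨ a g + a h , b g + b h , c g + c h + (a g * b h - b g * a h) ⟩

    ε : Heis
    ε = ⟨ 0ℤ , 0ℤ , 0ℤ ⟩

    _⁻¹ : Heis → Heis
    g ⁻¹ = ⟨ - a g , - b g , - c g ⟩

    ≈-reflexive : ∀ {g h} → g ≡ h → g ≈ h
    ≈-reflexive refl = cong-reflexive refl , cong-reflexive refl

    a≈ : ∀ {g h} → g ≈ h → Cong M (a g) (a h)
    a≈ {g} {h} (p , _) = cong-trans (cong-sym (Z-vanishes (a g) _)) (cong-trans (S⇒M p) (Z-vanishes (a h) _))

    b≈ : ∀ {g h} → g ≈ h → Cong M (b g) (b h)
    b≈ {g} {h} (_ , q) = cong-trans (cong-sym (Z-vanishes (b g) _)) (cong-trans (R⇒M q) (Z-vanishes (b h) _))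

    triple : ∀ {a a′ b b′ c c′} → a ≡ a′ → b ≡ b′ → c ≡ c′ → ⟨ a , b , c ⟩ ≡ ⟨ a′ , b′ , c′ ⟩
    triple refl refl refl = refl

    via : ∀ {n a a′ b b′} → a ≡ a′ → Cong n a′ b′ → b ≡ b′ → Cong n a b
    via refl p refl = p

    ∙-cong : ∀ {g g′ h h′} → g ≈ g′ → h ≈ h′ → g ∙ h ≈ g′ ∙ h′
    ∙-cong {g} {g′} {h} {h′} p q =
        via (α-lemma (a g) (a h) (c g) (c h) Z _)
          (cong-+ (cong-+ (α≈ p) (α≈ q)) (cong-*ˡ (+ 2) (scale det)))
          (α-lemma (a g′) (a h′) (c g′) (c h′) Z _)
      , via (β-lemma (b g) (b h) (c g) (c h) Z _)
          (cong-+ (cong-+ (β≈ p) (β≈ q)) (S⇒R (scale det)))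
          (β-lemma (b g′) (b h′) (c g′) (c h′) Z _)
      where
      det : Cong M (a g * b h - b g * a h) (a g′ * b h′ - b g′ * a h′)
      det = cong-- (cong-* (a≈ p) (b≈ q)) (cong-* (b≈ p) (a≈ q))
      α-lemma : ∀ a a′ c c′ Z ω → a + a′ + Z * (+ 2 * (c + c′ + ω)) ≡ (a + Z * (+ 2 * c)) + (a′ + Z * (+ 2 * c′)) + + 2 * (Z * ω)
      α-lemma = solve-∀
      β-lemma : ∀ b b′ c c′ Z ω → b + b′ + Z * (c + c′ + ω) ≡ (b + Z * c) + (b′ + Z * c′) + Z * ω
      β-lemma = solve-∀

    ⁻¹-cong : ∀ {g h} → g ≈ h → g ⁻¹ ≈ h ⁻¹
    ⁻¹-cong {g} {h} (p , q) =
        via (α-lemma (a g) (c g) Z) (cong-neg p) (α-lemma (a h) (c h) Z)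
      , via (β-lemma (b g) (c g) Z) (cong-neg q) (β-lemma (b h) (c h) Z)
      where
      α-lemma : ∀ a c Z → - a + Z * (+ 2 * - c) ≡ - (a + Z * (+ 2 * c))
      α-lemma = solve-∀
      β-lemma : ∀ b c Z → - b + Z * - c ≡ - (b + Z * c)
      β-lemma = solve-∀

    assoc : ∀ g h k → (g ∙ h) ∙ k ≡ g ∙ (h ∙ k)
    assoc g h k = triple (ℤ.+-assoc (a g) (a h) (a k)) (ℤ.+-assoc (b g) (b h) (b k))
      (lemma (a g) (b g) (c g) (a h) (b h) (c h) (a k) (b k) (c k))
      where
      lemma : ∀ a b c a′ b′ c′ a″ b″ c″ →
        c + c′ + (a * b′ - b * a′) + c″ + ((a + a′) * b″ - (b + b′) * a″) ≡
        c + (c′ + c″ + (a′ * b″ - b′ * a″)) + (a * (b′ + b″) - b * (a′ + a″))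
      lemma = solve-∀

    identityˡ : ∀ g → ε ∙ g ≡ g
    identityˡ g = triple (ℤ.+-identityˡ _) (ℤ.+-identityˡ _) (lemma (a g) (b g) (c g))
      where
      lemma : ∀ a b c → 0ℤ + c + (0ℤ * b - 0ℤ * a) ≡ c
      lemma = solve-∀

    identityʳ : ∀ g → g ∙ ε ≡ g
    identityʳ g = triple (ℤ.+-identityʳ _) (ℤ.+-identityʳ _) (lemma (a g) (b g) (c g))
      where
      lemma : ∀ a b c → c + 0ℤ + (a * 0ℤ - b * 0ℤ) ≡ c
      lemma = solve-∀

    inverseˡ : ∀ g → g ⁻¹ ∙ g ≡ ε
    inverseˡ g = triple (ℤ.+-inverseˡ (a g)) (ℤ.+-inverseˡ (b g)) (lemma (a g) (b g) (c g))
      where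
      lemma : ∀ a b c → - c + c + (- a * b - - b * a) ≡ 0ℤ
      lemma = solve-∀

    inverseʳ : ∀ g → g ∙ g ⁻¹ ≡ ε
    inverseʳ g = triple (ℤ.+-inverseʳ (a g)) (ℤ.+-inverseʳ (b g)) (lemma (a g) (b g) (c g))
      where
      lemma : ∀ a b c → c + - c + (a * - b - b * - a) ≡ 0ℤ
      lemma = solve-∀

    group : Group 0ℓ 0ℓ
    group = record
      { Carrier = Heis
      ; _≈_ = _≈_
      ; _∙_ = _∙_
      ; ε = ε
      ; _⁻¹ = _⁻¹
      ; isGroup = record
        { isMonoid = record
          { isSemigroup = record
            { isMagma = record
              { isEquivalence = record
                { refl = ≈-reflexive refl
                ; sym = λ (p , q) → cong-sym p , cong-sym q
                ; trans = λ (p , q) (p′ , q′) → cong-trans p p′ , cong-trans q q′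
                }
              ; ∙-cong = ∙-cong
              }
            ; assoc = λ g h k → ≈-reflexive (assoc g h k)
            }
          ; identity = (λ g → ≈-reflexive (identityˡ g)) , (λ g → ≈-reflexive (identityʳ g))
          }
        ; inverse = (λ g → ≈-reflexive (inverseˡ g)) , (λ g → ≈-reflexive (inverseʳ g))
        ; ⁻¹-cong = ⁻¹-cong
        }
      }

    open Mult (Group.monoid group) using () renaming (_×_ to pow)

    w y : Heis
    w = ⟨ 0ℤ , 1ℤ , 0ℤ ⟩
    y = ⟨ 1ℤ , 0ℤ , 0ℤ ⟩

    -- The determinant form is alternating, so it does not contribute to powers.
    pow-multiple : ∀ k g → pow k g ≡ ⟨ + k * a g , + k * b g , + k * c g ⟩
    pow-multiple zero    g = refl
    pow-multiple (suc k) g = trans (cong (g ∙_) (pow-multiple k g))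
      (triple (lemma (a g) (+ k)) (lemma (b g) (+ k)) (lemma′ (a g) (b g) (c g) (+ k)))
      where
      lemma : ∀ a k → a + k * a ≡ (1ℤ + k) * a
      lemma = solve-∀
      lemma′ : ∀ a b c k → c + k * c + (a * (k * b) - b * (k * a)) ≡ (1ℤ + k) * c
      lemma′ = solve-∀

    pow-y≡ : ∀ k → pow k y ≡ ⟨ + k , 0ℤ , 0ℤ ⟩
    pow-y≡ k = trans (pow-multiple k y) (triple (ℤ.*-identityʳ (+ k)) (ℤ.*-zeroʳ (+ k)) (ℤ.*-zeroʳ (+ k)))

    pow-w≡ : ∀ k → pow k w ≡ ⟨ 0ℤ , + k , 0ℤ ⟩
    pow-w≡ k = trans (pow-multiple k w) (triple (ℤ.*-zeroʳ (+ k)) (ℤ.*-identityʳ (+ k)) (ℤ.*-zeroʳ (+ k)))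

    -- The linear part (a, b) ↦ (-a, b - a) has determinant -1, so `c` changes sign; the additive
    -- term -a is dictated by `η y = w⁻¹y⁻¹ = ⟨-1, -1, -1⟩`.
    η : Heis → Heis
    η g = ⟨ - a g , b g - a g , - c g - a g ⟩

    η-cong : ∀ {g h} → g ≈ h → η g ≈ η h
    η-cong {g} {h} p =
        via (α-lemma (a g) (c g) Z) (cong-- (cong-neg (α≈ p)) (cong-*ˡ (+ 2) (scale (a≈ p))))
            (α-lemma (a h) (c h) Z)
      , via (β-lemma (a g) (b g) (c g) Z) (cong-- (cong-- (β≈ p) (S⇒R (α≈ p))) (S⇒R (scale (a≈ p))))
            (β-lemma (a h) (b h) (c h) Z)
      where
      α-lemma : ∀ a c Z → - a + Z * (+ 2 * (- c - a)) ≡ - (a + Z * (+ 2 * c)) - + 2 * (Z * a)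
      α-lemma = solve-∀
      β-lemma : ∀ a b c Z → b - a + Z * (- c - a) ≡ b + Z * c - (a + Z * (+ 2 * c)) - Z * a
      β-lemma = solve-∀

    η-homo : ∀ g h → η (g ∙ h) ≡ η g ∙ η h
    η-homo g h = triple (ℤ.neg-distrib-+ (a g) (a h)) (lemma (a g) (b g) (a h) (b h))
      (lemma′ (a g) (b g) (c g) (a h) (b h) (c h))
      where
      lemma : ∀ a b a′ b′ → b + b′ - (a + a′) ≡ b - a + (b′ - a′)
      lemma = solve-∀
      lemma′ : ∀ a b c a′ b′ c′ → - (c + c′ + (a * b′ - b * a′)) - (a + a′) ≡
        - c - a + (- c′ - a′) + (- a * (b′ - a′) - (b - a) * - a′)
      lemma′ = solve-∀

    η-η : ∀ g → w ∙ η (η g) ≡ g ∙ w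
    η-η g = triple (lemma (a g)) (lemma′ (a g) (b g)) (lemma″ (a g) (b g) (c g))
      where
      lemma : ∀ a → 0ℤ + - - a ≡ a + 0ℤ
      lemma = solve-∀
      lemma′ : ∀ a b → 1ℤ + (b - a - - a) ≡ b + 1ℤ
      lemma′ = solve-∀
      lemma″ : ∀ a b c → 0ℤ + (- (- c - a) - - a) + (0ℤ * (b - a - - a) - 1ℤ * - - a) ≡ c + 0ℤ + (a * 1ℤ - b * 0ℤ)
      lemma″ = solve-∀

    -- `V g` is the exponent of `w` when `g` is written as a power of `w` times a power of `y`;
    -- `F g` is the exponent of `y` in the opposite order. The central part is absorbed through z =
    -- y^(2Z) w^Z.
    V F : Heis → ℤ
    V g = β g + Z * (a g * b g)
    F g = α g - + 2 * (Z * (a g * b g))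

    ab≈ : ∀ {g h} → Cong M (a g) (a h) → Cong M (b g) (b h) → Cong S (Z * (a g * b g)) (Z * (a h * b h))
    ab≈ p q = scale (cong-* p q)

    V-cong : ∀ {g h} → g ≈ h → Cong R (V g) (V h)
    V-cong {g} {h} p = cong-+ (β≈ p) (S⇒R (ab≈ {g} {h} (a≈ p) (b≈ p)))

    F-cong : ∀ {g h} → g ≈ h → Cong S (F g) (F h)
    F-cong {g} {h} p = cong-- (α≈ p) (cong-*ˡ (+ 2) (ab≈ {g} {h} (a≈ p) (b≈ p)))

    -- Modulo `m`, `V` is `b` and `F` is `a`. Hence the product `a b` is known modulo `m`, its
    -- multiple by `Z` is known modulo `S`, and `α` and `β` can be recovered.
    V-F-injective : ∀ {g h} → Cong R (V g) (V h) → Cong S (F g) (F h) → g ≈ h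
    V-F-injective {g} {h} p q =
        via (α-lemma (α g) _) (cong-+ q (cong-*ˡ (+ 2) ab)) (α-lemma (α h) _)
      , via (β-lemma (β g) _) (cong-- p (S⇒R ab)) (β-lemma (β h) _)
      where
      F≡a : ∀ g → Cong M (F g) (a g)
      F≡a g = cong-trans (cong-reflexive (lemma (a g) (b g) (c g) Z)) (Z-vanishes (a g) _)
        where
        lemma : ∀ a b c Z → a + Z * (+ 2 * c) - + 2 * (Z * (a * b)) ≡ a + Z * (+ 2 * c - + 2 * (a * b))
        lemma = solve-∀
      V≡b : ∀ g → Cong M (V g) (b g)
      V≡b g = cong-trans (cong-reflexive (lemma (a g) (b g) (c g) Z)) (Z-vanishes (b g) _)
        where
        lemma : ∀ a b c Z → b + Z * c + Z * (a * b) ≡ b + Z * (c + a * b)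
        lemma = solve-∀
      ab : Cong S (Z * (a g * b g)) (Z * (a h * b h))
      ab = ab≈ {g} {h} (cong-trans (cong-sym (F≡a g)) (cong-trans (S⇒M q) (F≡a h)))
                       (cong-trans (cong-sym (V≡b g)) (cong-trans (R⇒M p) (V≡b h)))
      α-lemma : ∀ α d → α ≡ α - + 2 * d + + 2 * d
      α-lemma = solve-∀
      β-lemma : ∀ β d → β ≡ β + d - d
      β-lemma = solve-∀

    V-y : ∀ g k → V (g ∙ ⟨ k , 0ℤ , 0ℤ ⟩) ≡ V g
    V-y g k = lemma (a g) (b g) (c g) k Z
      where
      lemma : ∀ a b c k Z → b + 0ℤ + Z * (c + 0ℤ + (a * 0ℤ - b * k)) + Z * ((a + k) * (b + 0ℤ)) ≡ b + Z * c + Z * (a * b)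
      lemma = solve-∀

    F-w : ∀ g l → F (g ∙ ⟨ 0ℤ , l , 0ℤ ⟩) ≡ F g
    F-w g l = lemma (a g) (b g) (c g) l Z
      where
      lemma : ∀ a b c l Z → a + 0ℤ + Z * (+ 2 * (c + 0ℤ + (a * l - b * 0ℤ))) - + 2 * (Z * ((a + 0ℤ) * (b + l))) ≡
        a + Z * (+ 2 * c) - + 2 * (Z * (a * b))
      lemma = solve-∀

    -- Moving y^k to the left past w^b costs z^(-2bk), and each `z` adds 2Z to the exponent of `y`.
    F-y : ∀ g k → F (g ∙ ⟨ k , 0ℤ , 0ℤ ⟩) ≡ F g + (k + - + 4 * (Z * (b g * k)))
    F-y g k = lemma (a g) (b g) (c g) k Z
      where
      lemma : ∀ a b c k Z → a + k + Z * (+ 2 * (c + 0ℤ + (a * 0ℤ - b * k))) - + 2 * (Z * ((a + k) * (b + 0ℤ))) ≡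
        a + Z * (+ 2 * c) - + 2 * (Z * (a * b)) + (k + - + 4 * (Z * (b * k)))
      lemma = solve-∀

    V-w : ∀ g l → V (g ∙ ⟨ 0ℤ , l , 0ℤ ⟩) ≡ V g + (l + + 2 * (Z * (a g * l)))
    V-w g l = lemma (a g) (b g) (c g) l Z
      where
      lemma : ∀ a b c l Z → b + l + Z * (c + 0ℤ + (a * l - b * 0ℤ)) + Z * ((a + 0ℤ) * (b + l)) ≡
        b + Z * c + Z * (a * b) + (l + + 2 * (Z * (a * l)))
      lemma = solve-∀

    correct : ℤ → ℤ → ℤ → ℤ
    correct n u δ = δ - n * (Z * (u * δ))

    -- Multiplication by 1 - n Z u inverts multiplication by 1 + n Z u, since Z² ≡ 0.
    correct-solves : ∀ {q} → (∀ {a b} → Cong S a b → Cong q a b) → (∀ {a b} → Cong q a b → Cong M a b) →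
      ∀ n u δ {k} → Cong q k (correct n u δ) → Cong q (k + n * (Z * (u * k))) δ
    correct-solves S⇒q q⇒M n u δ {k} p = cong-trans
      (cong-+ p (S⇒q (cong-*ˡ n (scale (cong-*ˡ u (q⇒M p))))))
      (S⇒q (by (- (n * n * u * u * δ * + s)) (lemma n u δ (+ s) M)))
      where
      lemma : ∀ n u δ s M → let Z = s * M in
        δ - n * (Z * (u * δ)) + n * (Z * (u * (δ - n * (Z * (u * δ))))) ≡ δ + - (n * n * u * u * δ * s) * (Z * M)
      lemma = solve-∀

    difference : ∀ u v → u + (v - u) ≡ v
    difference = solve-∀

    nR⇒R : ∀ {a b} → Cong (+ nR) a b → Cong R a b
    nR⇒R {a} {b} = subst (λ n → Cong n a b) nR≡R

    nS⇒S : ∀ {a b} → Cong (+ nS) a b → Cong S a b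
    nS⇒S {a} {b} = subst (λ n → Cong n a b) nS≡S

    R⇒nR : ∀ {a b} → Cong R a b → Cong (+ nR) a b
    R⇒nR {a} {b} = subst (λ n → Cong n a b) (sym nR≡R)

    S⇒nS : ∀ {a b} → Cong S a b → Cong (+ nS) a b
    S⇒nS {a} {b} = subst (λ n → Cong n a b) (sym nS≡S)

    vtx : Heis → Fin nR
    vtx g = residue nR (V g)

    fac : Heis → Fin nS
    fac g = residue nS (F g)

    vtx-eq : ∀ {g h} → Cong R (V g) (V h) → vtx g ≡ vtx h
    vtx-eq p = residue-cong nR (R⇒nR p)

    fac-eq : ∀ {g h} → Cong S (F g) (F h) → fac g ≡ fac h
    fac-eq p = residue-cong nS (S⇒nS p)

    eq-vtx : ∀ {g h} → vtx g ≡ vtx h → Cong R (V g) (V h)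
    eq-vtx eq = nR⇒R (residue-injective nR eq)

    eq-fac : ∀ {g h} → fac g ≡ fac h → Cong S (F g) (F h)
    eq-fac eq = nS⇒S (residue-injective nS eq)

    vtx-coset : ∀ {g h} → vtx g ≡ vtx h → ∃ λ k → h ≈ g ∙ pow k y
    vtx-coset {g} {h} eq = k , subst (λ u → h ≈ g ∙ u) (sym (pow-y≡ k)) (V-F-injective
        (cong-trans (cong-sym (eq-vtx {g} {h} eq)) (cong-reflexive (sym (V-y g (+ k)))))
        (via (sym (difference (F g) (F h)))
          (cong-+ (cong-reflexive {a = F g} refl)
            (cong-sym (correct-solves (λ p → p) S⇒M (- + 4) (b g) (F h - F g) (nS⇒S (residue-spec nS _)))))
          (F-y g (+ k))))
      where
      k : ℕ
      k = toℕ (residue nS (correct (- + 4) (b g) (F h - F g)))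

    fac-coset : ∀ {g h} → fac g ≡ fac h → ∃ λ k → h ≈ g ∙ pow k w
    fac-coset {g} {h} eq = k , subst (λ u → h ≈ g ∙ u) (sym (pow-w≡ k)) (V-F-injective
        (via (sym (difference (V g) (V h)))
          (cong-+ (cong-reflexive {a = V g} refl)
            (cong-sym (correct-solves S⇒R R⇒M (+ 2) (a g) (V h - V g) (nR⇒R (residue-spec nR _)))))
          (V-w g (+ k)))
        (cong-trans (cong-sym (eq-fac {g} {h} eq)) (cong-reflexive (sym (F-w g (+ k))))))
      where
      k : ℕ
      k = toℕ (residue nR (correct (+ 2) (a g) (V h - V g)))

    -- In w^v y^k the coordinate `V` is `v` for every `k`; this `k` compensates the shift in `F`.
    point : ℤ → ℤ → Heis
    point v f = ⟨ 0ℤ , v , 0ℤ ⟩ ∙ ⟨ correct (- + 4) v f , 0ℤ , 0ℤ ⟩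

    V-point : ∀ v f → V (point v f) ≡ v
    V-point v f = trans (V-y ⟨ 0ℤ , v , 0ℤ ⟩ _) (lemma v Z)
      where
      lemma : ∀ v Z → v + Z * 0ℤ + Z * (0ℤ * v) ≡ v
      lemma = solve-∀

    F-point : ∀ v f → Cong S (F (point v f)) f
    F-point v f = cong-trans (cong-reflexive (trans (F-y ⟨ 0ℤ , v , 0ℤ ⟩ k) (lemma v Z _)))
      (correct-solves (λ p → p) S⇒M (- + 4) v f (cong-reflexive refl))
      where
      k : ℤ
      k = correct (- + 4) v f
      lemma : ∀ v Z d → 0ℤ + Z * (+ 2 * 0ℤ) - + 2 * (Z * (0ℤ * v)) + d ≡ d
      lemma = solve-∀

    pow-y : pow nS y ≈ ε
    pow-y = subst (_≈ ε) (sym (pow-y≡ nS))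
      (by 1ℤ (trans (cong (_+ Z * (+ 2 * 0ℤ)) nS≡S) (lemma S (Z * (+ 2 * 0ℤ)))) , cong-reflexive refl)
      where
      lemma : ∀ S d → S + d ≡ 0ℤ + d + 1ℤ * S
      lemma = solve-∀

    pow-w : pow nR w ≈ ε
    pow-w = subst (_≈ ε) (sym (pow-w≡ nR))
      (cong-reflexive refl , by 1ℤ (trans (cong (_+ Z * 0ℤ) nR≡R) (lemma R (Z * 0ℤ))))
      where
      lemma : ∀ R d → R + d ≡ 0ℤ + d + 1ℤ * R
      lemma = solve-∀

    y≉ε : ¬ y ≈ ε
    y≉ε p with () ← cong-unique 1<m (ℕ.<-trans (ℕ.s≤s ℕ.z≤n) 1<m) (a≈ p)

    heisenberg : HalfRotary nR nS
    heisenberg = record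
      { group = group
      ; w = w
      ; y = y
      ; y≉ε = y≉ε
      ; pow-w = pow-w
      ; pow-y = pow-y
      ; η = η
      ; η-cong = η-cong
      ; η-homo = λ g h → ≈-reflexive (η-homo g h)
      ; η-w = ≈-reflexive refl
      ; η-y = ≈-reflexive refl
      ; η-η = λ g → ≈-reflexive (η-η g)
      ; vtx = vtx
      ; fac = fac
      ; vtx-cong = λ {g} {h} p → vtx-eq {g} {h} (V-cong p)
      ; fac-cong = λ {g} {h} p → fac-eq {g} {h} (F-cong p)
      ; vtx-y = λ g → cong (residue nR) (V-y g 1ℤ)
      ; fac-w = λ g → cong (residue nS) (F-w g 1ℤ)
      ; vtx-coset = λ {g} {h} → vtx-coset {g} {h}
      ; fac-coset = λ {g} {h} → fac-coset {g} {h}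
      ; vtx-fac-injective = λ {g} {h} v≡ f≡ → V-F-injective (eq-vtx {g} {h} v≡) (eq-fac {g} {h} f≡)
      ; dart = λ v f → point (+ toℕ v) (+ toℕ f)
      ; vtx-dart = λ v f → trans (cong (residue nR) (V-point (+ toℕ v) (+ toℕ f))) (residue-toℕ nR v)
      ; fac-dart = λ v f → trans (residue-cong nS (S⇒nS (F-point (+ toℕ v) (+ toℕ f)))) (residue-toℕ nS f)
      }

    open HalfRotary heisenberg using (word; Irreflexible)

    module _ (i j : ℕ) where

      -- The word for w^e and y^e, so that `e = 1` and `e = -1` treat the relation and its mirror
      -- image together. The palindrome `ywy` becomes ⟨2e, e, 0⟩ in both cases.
      word-at : ℤ → ℤ → Heis
      word-at k e = ⟨ + j * e + + 2 * (k * e) , + i * e + k * e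
                    , + j * e * (k * e) - + i * e * (+ j * e + + 2 * (k * e)) ⟩

      swapped-at : ℤ → Heis
      swapped-at e = ⟨ + j * e , + i * e , + j * e * (+ i * e) ⟩

      word≡ : ∀ k e → let i = + i ; j = + j in
        ⟨ i * 0ℤ , i * e , i * 0ℤ ⟩ ∙ (⟨ j * e , j * 0ℤ , j * 0ℤ ⟩ ∙ ⟨ k * (+ 2 * e) , k * e , k * 0ℤ ⟩) ≡ word-at k e
      word≡ k e = triple (lemma (+ i) (+ j) k e) (lemma′ (+ i) (+ j) k e) (lemma″ (+ i) (+ j) k e)
        where
        lemma : ∀ i j k e → i * 0ℤ + (j * e + k * (+ 2 * e)) ≡ j * e + + 2 * (k * e)
        lemma = solve-∀
        lemma′ : ∀ i j k e → i * e + (j * 0ℤ + k * e) ≡ i * e + k * e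
        lemma′ = solve-∀
        lemma″ : ∀ i j k e →
          i * 0ℤ + (j * 0ℤ + k * 0ℤ + (j * e * (k * e) - j * 0ℤ * (k * (+ 2 * e))))
            + (i * 0ℤ * (j * 0ℤ + k * e) - i * e * (j * e + k * (+ 2 * e)))
          ≡ j * e * (k * e) - i * e * (j * e + + 2 * (k * e))
        lemma″ = solve-∀

      swapped≡ : ∀ e → let i = + i ; j = + j in
        ⟨ j * e , j * 0ℤ , j * 0ℤ ⟩ ∙ ⟨ i * 0ℤ , i * e , i * 0ℤ ⟩ ≡ swapped-at e
      swapped≡ e = triple (lemma (+ i) (+ j) e) (lemma′ (+ i) (+ j) e) (lemma″ (+ i) (+ j) e)
        where
        lemma : ∀ i j e → j * e + i * 0ℤ ≡ j * e
        lemma = solve-∀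
        lemma′ : ∀ i j e → j * 0ℤ + i * e ≡ i * e
        lemma′ = solve-∀
        lemma″ : ∀ i j e → j * 0ℤ + i * 0ℤ + (j * e * (i * e) - j * 0ℤ * (i * 0ℤ)) ≡ j * e * (i * e)
        lemma″ = solve-∀

      -- y^j w^i = w^i y^j z^(2ij) and z = (ywy)^Z, hence k = 2Zij.
      k : ℕ
      k = 2 ℕ.* (s ℕ.* m) ℕ.* (i ℕ.* j)

      k≡ : + k ≡ + 2 * Z * (+ i * + j)
      k≡ = trans (ℤ.pos-* (2 ℕ.* (s ℕ.* m)) (i ℕ.* j)) (cong₂ _*_
        (trans (ℤ.pos-* 2 (s ℕ.* m)) (cong (+ 2 *_) (ℤ.pos-* s m))) (ℤ.pos-* i j))

      word-w-y : word i j k w y ≡ word-at (+ k) 1ℤ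
      word-w-y = trans (cong₂ _∙_ (pow-multiple i w) (cong₂ _∙_ (pow-multiple j y) (pow-multiple k _))) (word≡ (+ k) 1ℤ)

      swapped-w-y : pow j y ∙ pow i w ≡ swapped-at 1ℤ
      swapped-w-y = trans (cong₂ _∙_ (pow-multiple j y) (pow-multiple i w)) (swapped≡ 1ℤ)

      word-inverses : word i j k (w ⁻¹) (y ⁻¹) ≡ word-at (+ k) (- 1ℤ)
      word-inverses = trans (cong₂ _∙_ (pow-multiple i (w ⁻¹)) (cong₂ _∙_ (pow-multiple j (y ⁻¹)) (pow-multiple k _)))
        (word≡ (+ k) (- 1ℤ))

      swapped-inverses : pow j (y ⁻¹) ∙ pow i (w ⁻¹) ≡ swapped-at (- 1ℤ)
      swapped-inverses = trans (cong₂ _∙_ (pow-multiple j (y ⁻¹)) (pow-multiple i (w ⁻¹))) (swapped≡ (- 1ℤ))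

      relation : word i j k w y ≈ pow j y ∙ pow i w
      relation = subst₂ _≈_ (sym word-w-y) (sym swapped-w-y) (subst (λ k → word-at k 1ℤ ≈ swapped-at 1ℤ) (sym k≡)
        -- The terms linear in `Z` cancel; the rest is 4Z²ij(j - 2i), and Z² = sS. The second
        -- coordinate has half of this.
        ( by (+ 4 * + s * (+ i * + j) * (+ j - + 2 * + i)) (α-lemma (+ i) (+ j) (+ s) M)
        , S⇒R (by (+ 2 * + s * (+ i * + j) * (+ j - + 2 * + i)) (β-lemma (+ i) (+ j) (+ s) M)) ))
        where
        α-lemma : ∀ i j s M → let Z = s * M ; k = + 2 * Z * (i * j) in
          j * 1ℤ + + 2 * (k * 1ℤ) + Z * (+ 2 * (j * 1ℤ * (k * 1ℤ) - i * 1ℤ * (j * 1ℤ + + 2 * (k * 1ℤ))))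
            ≡ j * 1ℤ + Z * (+ 2 * (j * 1ℤ * (i * 1ℤ))) + + 4 * s * (i * j) * (j - + 2 * i) * (Z * M)
        α-lemma = solve-∀
        β-lemma : ∀ i j s M → let Z = s * M ; k = + 2 * Z * (i * j) in
          i * 1ℤ + k * 1ℤ + Z * (j * 1ℤ * (k * 1ℤ) - i * 1ℤ * (j * 1ℤ + + 2 * (k * 1ℤ)))
            ≡ i * 1ℤ + Z * (j * 1ℤ * (i * 1ℤ)) + + 2 * s * (i * j) * (j - + 2 * i) * (Z * M)
        β-lemma = solve-∀

      -- For the inverses the commutator is still z^(2ij), but the power of the palindrome becomes
      -- z^(-2ij). The relation would give z^(4ij) = 1, which in the coordinate `α` reads 8Zij ≡ 0
      -- modulo Zm.
      no-relation : ¬ m ∣ 8 ℕ.* (i ℕ.* j) → ¬ word i j k (w ⁻¹) (y ⁻¹) ≈ pow j (y ⁻¹) ∙ pow i (w ⁻¹)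
      no-relation m∤8ij rel = m∤8ij (∣⇒∣ᵤ (divides (+ 4 * + s * (+ i * + j) * (+ j - + 2 * + i) - q) 8ij≡))
        where
        rel′ : word-at (+ 2 * Z * (+ i * + j)) (- 1ℤ) ≈ swapped-at (- 1ℤ)
        rel′ = subst (λ k → word-at k (- 1ℤ) ≈ swapped-at (- 1ℤ)) k≡ (subst₂ _≈_ word-inverses swapped-inverses rel)
        q : ℤ
        q = Cong.quotient (α≈ rel′)
        -- The last summand is the difference of the two sides of the equation behind `α≈ rel′`, so
        -- `cancel` removes it.
        collect : ∀ i j s M q → let Z = s * M ; k = + 2 * Z * (i * j) ; e = - 1ℤ in
          Z * (+ 8 * (i * j)) ≡
            Z * ((+ 4 * s * (i * j) * (j - + 2 * i) - q) * M)
            + ((j * e + Z * (+ 2 * (j * e * (i * e))) + q * (Z * M))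
              - (j * e + + 2 * (k * e) + Z * (+ 2 * (j * e * (k * e) - i * e * (j * e + + 2 * (k * e))))))
        collect = solve-∀
        cancel : ∀ {u v} d → u ≡ v → d + (v - u) ≡ d
        cancel {u} d refl = lemma d u
          where
          lemma : ∀ d u → d + (u - u) ≡ d
          lemma = solve-∀
        instance
          Z-nonZero : ℤ.NonZero Z
          Z-nonZero = subst ℤ.NonZero (ℤ.pos-* s m) (ℕ.m*n≢0 s m)
        8ij≡ : + (8 ℕ.* (i ℕ.* j)) ≡ (+ 4 * + s * (+ i * + j) * (+ j - + 2 * + i) - q) * M
        8ij≡ = trans (trans (ℤ.pos-* 8 (i ℕ.* j)) (cong (+ 8 *_) (ℤ.pos-* i j)))
          (ℤ.*-cancelˡ-≡ Z _ _ (trans (collect (+ i) (+ j) (+ s) M q) (cancel _ (Cong.equation (α≈ rel′)))))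

      irreflexible : ¬ m ∣ 8 ℕ.* (i ℕ.* j) → Irreflexible
      irreflexible m∤8ij = record { i = i ; j = j ; k = k ; relation = relation ; no-relation = no-relation m∤8ij }

-- The metacyclic factor, whose only task is to enlarge the orders.

module MetacyclicGroup where

  open Extension
  open DirectProducts
  open Modular
  open import Algebra.Bundles using (Group)
  import Algebra.Properties.Monoid.Mult as Mult
  open import Data.Bool using (Bool; true; false; _xor_)
  open import Data.Bool.Properties using (xor-assoc; xor-identityʳ)
  open import Data.Fin using (Fin; zero; suc; toℕ; combine; remQuot)
  open import Data.Fin.Properties using (combine-injective; combine-remQuot)
  open import Data.Integer using (ℤ; +_; _+_; _*_; -_; _-_; 0ℤ; 1ℤ)
  import Data.Integer.Properties as ℤ
  open import Data.Integer.Tactic.RingSolver using (solve-∀)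
  open import Data.Nat using (ℕ; zero; suc; NonZero)
  import Data.Nat as ℕ
  import Data.Nat.Properties as ℕ
  open import Data.Product using (∃; _×_; _,_; proj₁; proj₂)
  open import Level using (0ℓ)
  open import Relation.Binary.PropositionalEquality

  module Metacyclic (R S : ℕ) .{{_ : NonZero R}} .{{_ : NonZero S}} where

    -- ⟨ k , e , b ⟩ stands for w ^ b ∙ y ^ (2 k + e), where y inverts w.
    record Elt : Set where
      constructor ⟨_,_,_⟩
      field
        k : ℤ
        e : Bool
        b : ℤ
    open Elt

    -- Only the parity of the exponent of `y` acts on `w`. Kept as a `Bool`, it decides the sign,
    -- and the half exponent `k` is taken modulo `S`, half the order of `y`.
    carry : Bool → Bool → ℤ
    carry true  true  = 1ℤ
    carry true  false = 0ℤ
    carry false _     = 0ℤ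

    sgn : Bool → ℤ → ℤ
    sgn false b = b
    sgn true  b = - b

    infix 4 _≈_
    infixl 7 _∙_

    record _≈_ (g h : Elt) : Set where
      constructor ≈⟨_,_,_⟩
      field
        k≈ : Cong (+ S) (k g) (k h)
        e≡ : e g ≡ e h
        b≈ : Cong (+ R) (b g) (b h)

    _∙_ : Elt → Elt → Elt
    g ∙ h = ⟨ k g + k h + carry (e g) (e h) , e g xor e h , b g + sgn (e g) (b h) ⟩

    ε : Elt
    ε = ⟨ 0ℤ , false , 0ℤ ⟩

    _⁻¹ : Elt → Elt
    ⟨ k , false , b ⟩ ⁻¹ = ⟨ - k , false , - b ⟩
    ⟨ k , true  , b ⟩ ⁻¹ = ⟨ - k - 1ℤ , true , b ⟩

    triple : ∀ {k k′ e e′ b b′} → k ≡ k′ → e ≡ e′ → b ≡ b′ → ⟨ k , e , b ⟩ ≈ ⟨ k′ , e′ , b′ ⟩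
    triple k≡ e≡ b≡ = ≈⟨ cong-reflexive k≡ , e≡ , cong-reflexive b≡ ⟩

    sgn-cong : ∀ e {b b′} → Cong (+ R) b b′ → Cong (+ R) (sgn e b) (sgn e b′)
    sgn-cong false p = p
    sgn-cong true  p = cong-neg p

    sgn-0 : ∀ e → sgn e 0ℤ ≡ 0ℤ
    sgn-0 false = refl
    sgn-0 true  = refl

    sgn-+ : ∀ e a b → sgn e (a + b) ≡ sgn e a + sgn e b
    sgn-+ false a b = refl
    sgn-+ true  a b = ℤ.neg-distrib-+ a b

    sgn-xor : ∀ e e′ b → sgn (e xor e′) b ≡ sgn e (sgn e′ b)
    sgn-xor false e′    b = refl
    sgn-xor true  false b = refl
    sgn-xor true  true  b = sym (ℤ.neg-involutive b)

    carry-falseʳ : ∀ e → carry e false ≡ 0ℤ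
    carry-falseʳ false = refl
    carry-falseʳ true  = refl

    carry-assoc : ∀ e e′ e″ → carry e e′ + carry (e xor e′) e″ ≡ carry e′ e″ + carry e (e′ xor e″)
    carry-assoc false e′    e″    = ℤ.+-comm 0ℤ (carry e′ e″)
    carry-assoc true  false e″    = refl
    carry-assoc true  true  false = refl
    carry-assoc true  true  true  = refl

    ∙-cong : ∀ {g g′ h h′} → g ≈ g′ → h ≈ h′ → g ∙ h ≈ g′ ∙ h′
    ∙-cong {g} ≈⟨ p , refl , q ⟩ ≈⟨ p′ , refl , q′ ⟩ =
      ≈⟨ cong-+ (cong-+ p p′) (cong-reflexive refl) , refl , cong-+ q (sgn-cong (e g) q′) ⟩

    ⁻¹-cong : ∀ {g h} → g ≈ h → g ⁻¹ ≈ h ⁻¹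
    ⁻¹-cong {⟨ _ , false , _ ⟩} ≈⟨ p , refl , q ⟩ = ≈⟨ cong-neg p , refl , cong-neg q ⟩
    ⁻¹-cong {⟨ _ , true  , _ ⟩} ≈⟨ p , refl , q ⟩ = ≈⟨ cong-- (cong-neg p) (cong-reflexive refl) , refl , q ⟩

    assoc : ∀ g h l → (g ∙ h) ∙ l ≈ g ∙ (h ∙ l)
    assoc ⟨ k , e , b ⟩ ⟨ k′ , e′ , b′ ⟩ ⟨ k″ , e″ , b″ ⟩ = triple
      (trans (lemma k k′ k″ (carry e e′) (carry (e xor e′) e″))
        (trans (cong (λ c → k + (k′ + k″) + c) (carry-assoc e e′ e″))
          (lemma′ k k′ k″ (carry e′ e″) (carry e (e′ xor e″)))))
      (xor-assoc e e′ e″)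
      (trans (ℤ.+-assoc b (sgn e b′) _) (cong (λ c → b + c)
        (trans (cong (λ c → sgn e b′ + c) (sgn-xor e e′ b″)) (sym (sgn-+ e b′ (sgn e′ b″))))))
      where
      lemma : ∀ k k′ k″ c d → k + k′ + c + k″ + d ≡ k + (k′ + k″) + (c + d)
      lemma = solve-∀
      lemma′ : ∀ k k′ k″ c d → k + (k′ + k″) + (c + d) ≡ k + (k′ + k″ + c) + d
      lemma′ = solve-∀

    identityˡ : ∀ g → ε ∙ g ≈ g
    identityˡ g = triple (trans (ℤ.+-identityʳ _) (ℤ.+-identityˡ (k g))) refl (ℤ.+-identityˡ (b g))

    identityʳ : ∀ g → g ∙ ε ≈ g
    identityʳ g = triple (trans (cong (λ c → k g + 0ℤ + c) (carry-falseʳ (e g))) (trans (ℤ.+-identityʳ _) (ℤ.+-identityʳ (k g))))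
      (xor-identityʳ (e g)) (trans (cong (λ c → b g + c) (sgn-0 (e g))) (ℤ.+-identityʳ (b g)))

    inverseˡ : ∀ g → g ⁻¹ ∙ g ≈ ε
    inverseˡ ⟨ k , false , b ⟩ = triple (lemma k) refl (ℤ.+-inverseˡ b)
      where
      lemma : ∀ k → - k + k + 0ℤ ≡ 0ℤ
      lemma = solve-∀
    inverseˡ ⟨ k , true  , b ⟩ = triple (lemma k) refl (ℤ.+-inverseʳ b)
      where
      lemma : ∀ k → - k - 1ℤ + k + 1ℤ ≡ 0ℤ
      lemma = solve-∀

    inverseʳ : ∀ g → g ∙ g ⁻¹ ≈ ε
    inverseʳ ⟨ k , false , b ⟩ = triple (lemma k) refl (ℤ.+-inverseʳ b)
      where
      lemma : ∀ k → k + - k + 0ℤ ≡ 0ℤ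
      lemma = solve-∀
    inverseʳ ⟨ k , true  , b ⟩ = triple (lemma k) refl (ℤ.+-inverseʳ b)
      where
      lemma : ∀ k → k + (- k - 1ℤ) + 1ℤ ≡ 0ℤ
      lemma = solve-∀

    group : Group 0ℓ 0ℓ
    group = record
      { Carrier = Elt
      ; _≈_ = _≈_
      ; _∙_ = _∙_
      ; ε = ε
      ; _⁻¹ = _⁻¹
      ; isGroup = record
        { isMonoid = record
          { isSemigroup = record
            { isMagma = record
              { isEquivalence = record
                { refl = triple refl refl refl
                ; sym = λ { ≈⟨ p , e , q ⟩ → ≈⟨ cong-sym p , sym e , cong-sym q ⟩ }
                ; trans = λ { ≈⟨ p , e , q ⟩ ≈⟨ p′ , e′ , q′ ⟩ → ≈⟨ cong-trans p p′ , trans e e′ , cong-trans q q′ ⟩ }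
                }
              ; ∙-cong = ∙-cong
              }
            ; assoc = assoc
            }
          ; identity = identityˡ , identityʳ
          }
        ; inverse = inverseˡ , inverseʳ
        ; ⁻¹-cong = ⁻¹-cong
        }
      }

    open Mult (Group.monoid group) using () renaming (_×_ to pow)
    private module G = Group group

    w y : Elt
    w = ⟨ 0ℤ , false , 1ℤ ⟩
    y = ⟨ 0ℤ , true , 0ℤ ⟩

    pow-even : ∀ i j b → pow i ⟨ j , false , b ⟩ ≈ ⟨ + i * j , false , + i * b ⟩
    pow-even zero    j b = triple refl refl refl
    pow-even (suc i) j b = G.trans (G.∙-congˡ {⟨ j , false , b ⟩} (pow-even i j b)) (triple (lemma (+ i) j) refl (lemma′ (+ i) b))
      where
      lemma : ∀ i j → j + i * j + 0ℤ ≡ (1ℤ + i) * j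
      lemma = solve-∀
      lemma′ : ∀ i b → b + i * b ≡ (1ℤ + i) * b
      lemma′ = solve-∀

    pow-w≈ : ∀ i → pow i w ≈ ⟨ 0ℤ , false , + i ⟩
    pow-w≈ i = G.trans (pow-even i 0ℤ 1ℤ) (triple (ℤ.*-zeroʳ (+ i)) refl (ℤ.*-identityʳ (+ i)))

    pow-y-even : ∀ i → pow (i ℕ.* 2) y ≈ ⟨ + i , false , 0ℤ ⟩
    pow-y-even i = G.trans (G.sym (Mult.×-assocˡ (Group.monoid group) y i 2))
      (G.trans (pow-even i 1ℤ 0ℤ) (triple (ℤ.*-identityʳ (+ i)) refl (ℤ.*-zeroʳ (+ i))))

    pow-y-odd : ∀ i → pow (suc (i ℕ.* 2)) y ≈ ⟨ + i , true , 0ℤ ⟩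
    pow-y-odd i = G.trans (G.∙-congˡ {y} (pow-y-even i)) (triple (lemma (+ i)) refl refl)
      where
      lemma : ∀ i → 0ℤ + i + 0ℤ ≡ i
      lemma = solve-∀

    -- (w⁻¹y⁻¹)² = y⁻², so even powers of `y` are simply inverted; an odd power leaves one factor
    -- w⁻¹y⁻¹, and -2k - 1 = 2(-k - 1) + 1.
    η : Elt → Elt
    η ⟨ k , false , b ⟩ = ⟨ - k , false , b ⟩
    η ⟨ k , true  , b ⟩ = ⟨ - k - 1ℤ , true , b - 1ℤ ⟩

    η-cong : ∀ {g h} → g ≈ h → η g ≈ η h
    η-cong {⟨ _ , false , _ ⟩} ≈⟨ p , refl , q ⟩ = ≈⟨ cong-neg p , refl , q ⟩
    η-cong {⟨ _ , true  , _ ⟩} ≈⟨ p , refl , q ⟩ =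
      ≈⟨ cong-- (cong-neg p) (cong-reflexive refl) , refl , cong-- q (cong-reflexive refl) ⟩

    η-homo : ∀ g h → η (g ∙ h) ≈ η g ∙ η h
    η-homo ⟨ k , false , b ⟩ ⟨ k′ , false , b′ ⟩ = triple (lemma k k′) refl refl
      where
      lemma : ∀ k k′ → - (k + k′ + 0ℤ) ≡ - k + - k′ + 0ℤ
      lemma = solve-∀
    η-homo ⟨ k , false , b ⟩ ⟨ k′ , true  , b′ ⟩ = triple (lemma k k′) refl (ℤ.+-assoc b b′ (- 1ℤ))
      where
      lemma : ∀ k k′ → - (k + k′ + 0ℤ) - 1ℤ ≡ - k + (- k′ - 1ℤ) + 0ℤ
      lemma = solve-∀
    η-homo ⟨ k , true  , b ⟩ ⟨ k′ , false , b′ ⟩ = triple (lemma k k′) refl (lemma′ b b′)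
      where
      lemma : ∀ k k′ → - (k + k′ + 0ℤ) - 1ℤ ≡ - k - 1ℤ + - k′ + 0ℤ
      lemma = solve-∀
      lemma′ : ∀ b b′ → b + - b′ - 1ℤ ≡ b - 1ℤ + - b′
      lemma′ = solve-∀
    η-homo ⟨ k , true  , b ⟩ ⟨ k′ , true  , b′ ⟩ = triple (lemma k k′) refl (lemma′ b b′)
      where
      lemma : ∀ k k′ → - (k + k′ + 1ℤ) ≡ - k - 1ℤ + (- k′ - 1ℤ) + 1ℤ
      lemma = solve-∀
      lemma′ : ∀ b b′ → b + - b′ ≡ b - 1ℤ + - (b′ - 1ℤ)
      lemma′ = solve-∀

    η-η : ∀ g → w ∙ η (η g) ≈ g ∙ w
    η-η ⟨ k , false , b ⟩ = triple (lemma k) refl (ℤ.+-comm 1ℤ b)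
      where
      lemma : ∀ k → 0ℤ + - - k + 0ℤ ≡ k + 0ℤ + 0ℤ
      lemma = solve-∀
    η-η ⟨ k , true  , b ⟩ = triple (lemma k) refl (lemma′ b)
      where
      lemma : ∀ k → 0ℤ + (- (- k - 1ℤ) - 1ℤ) + 0ℤ ≡ k + 0ℤ + 0ℤ
      lemma = solve-∀
      lemma′ : ∀ b → 1ℤ + (b - 1ℤ - 1ℤ) ≡ b + - 1ℤ
      lemma′ = solve-∀

    bool : Fin 2 → Bool
    bool zero       = false
    bool (suc zero) = true

    bit : Bool → Fin 2
    bit false = zero
    bit true  = suc zero

    bool-bit : ∀ e → bool (bit e) ≡ e
    bool-bit false = refl
    bool-bit true  = refl

    bit-bool : ∀ i → bit (bool i) ≡ i
    bit-bool zero       = refl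
    bit-bool (suc zero) = refl

    vtx : Elt → Fin R
    vtx g = residue R (b g)

    fac : Elt → Fin (2 ℕ.* S)
    fac g = combine (bit (e g)) (residue S (k g))

    eq-fac : ∀ {g h} → fac g ≡ fac h → e g ≡ e h × Cong (+ S) (k g) (k h)
    eq-fac {g} {h} eq with combine-injective (bit (e g)) (residue S (k g)) (bit (e h)) (residue S (k h)) eq
    ... | e≡ , k≡ = trans (sym (bool-bit (e g))) (trans (cong bool e≡) (bool-bit (e h))) , residue-injective S k≡

    shift : ∀ {q a a′} j → Cong q j (a′ - a) → Cong q a′ (a + j)
    shift {q} {a} {a′} j p = cong-trans (cong-reflexive (lemma a a′)) (cong-+ (cong-reflexive {a = a} refl) (cong-sym p))
      where
      lemma : ∀ a a′ → a′ ≡ a + (a′ - a)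
      lemma = solve-∀

    vtx-coset : ∀ {g h} → vtx g ≡ vtx h → ∃ λ i → h ≈ g ∙ pow i y
    vtx-coset {⟨ k , e , b ⟩} {⟨ k′ , e′ , b′ ⟩} eq = go e e′
      where
      b≈ : Cong (+ R) b′ b
      b≈ = cong-sym (residue-injective R eq)
      even odd : ℕ
      even = toℕ (residue S (k′ - k))
      -- Passing from an odd to an even exponent by an odd one produces a carry, which has to be
      -- subtracted.
      odd  = toℕ (residue S (k′ - (k + 1ℤ)))
      k≈ : Cong (+ S) k′ (k + + even)
      k≈ = shift (+ even) (residue-spec S _)
      pad-0 : ∀ a b → a + b ≡ a + b + 0ℤ
      pad-0 = solve-∀
      pad-1 : ∀ a b → a + 1ℤ + b ≡ a + b + 1ℤ
      pad-1 = solve-∀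
      go : ∀ e e′ → ∃ λ i → ⟨ k′ , e′ , b′ ⟩ ≈ ⟨ k , e , b ⟩ ∙ pow i y
      go false false = even ℕ.* 2 , G.trans
        ≈⟨ cong-trans k≈ (cong-reflexive (pad-0 k _)) , refl , cong-trans b≈ (cong-reflexive (sym (ℤ.+-identityʳ b))) ⟩
        (G.∙-congˡ {⟨ k , false , b ⟩} (G.sym (pow-y-even even)))
      go true true = even ℕ.* 2 , G.trans
        ≈⟨ cong-trans k≈ (cong-reflexive (pad-0 k _)) , refl , cong-trans b≈ (cong-reflexive (sym (ℤ.+-identityʳ b))) ⟩
        (G.∙-congˡ {⟨ k , true , b ⟩} (G.sym (pow-y-even even)))
      go false true = suc (even ℕ.* 2) , G.trans
        ≈⟨ cong-trans k≈ (cong-reflexive (pad-0 k _)) , refl , cong-trans b≈ (cong-reflexive (sym (ℤ.+-identityʳ b))) ⟩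
        (G.∙-congˡ {⟨ k , false , b ⟩} (G.sym (pow-y-odd even)))
      go true false = suc (odd ℕ.* 2) , G.trans
        ≈⟨ cong-trans (shift (+ odd) (residue-spec S _)) (cong-reflexive (pad-1 k _)) , refl
         , cong-trans b≈ (cong-reflexive (sym (ℤ.+-identityʳ b))) ⟩
        (G.∙-congˡ {⟨ k , true , b ⟩} (G.sym (pow-y-odd odd)))

    fac-coset : ∀ {g h} → fac g ≡ fac h → ∃ λ i → h ≈ g ∙ pow i w
    fac-coset {g} {h} eq with eq-fac {g} {h} eq
    fac-coset {⟨ k , e , b ⟩} {⟨ k′ , _ , b′ ⟩} eq | refl , k≈ = i , G.trans
        ≈⟨ cong-trans (cong-sym k≈) (cong-reflexive (k-lemma e)) , sym (xor-identityʳ e) , shift _ (i-spec e) ⟩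
        (G.∙-congˡ {⟨ k , e , b ⟩} (G.sym (pow-w≈ i)))
      where
      i : ℕ
      i = toℕ (residue R (sgn e (b′ - b)))
      k-lemma : ∀ e → k ≡ k + 0ℤ + carry e false
      k-lemma e = sym (trans (cong (λ c → k + 0ℤ + c) (carry-falseʳ e)) (trans (ℤ.+-identityʳ _) (ℤ.+-identityʳ k)))
      sgn-sgn : ∀ e b → sgn e (sgn e b) ≡ b
      sgn-sgn false b = refl
      sgn-sgn true  b = ℤ.neg-involutive b
      i-spec : ∀ e → Cong (+ R) (sgn e (+ toℕ (residue R (sgn e (b′ - b))))) (b′ - b)
      i-spec e = cong-trans (sgn-cong e (residue-spec R _)) (cong-reflexive (sgn-sgn e _))

    pow-y : pow (2 ℕ.* S) y ≈ ε
    pow-y = subst (λ n → pow n y ≈ ε) (ℕ.*-comm S 2)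
      (G.trans (pow-y-even S) ≈⟨ by 1ℤ (lemma (+ S)) , refl , cong-reflexive refl ⟩)
      where
      lemma : ∀ n → n ≡ 0ℤ + 1ℤ * n
      lemma = solve-∀

    pow-w : pow R w ≈ ε
    pow-w = G.trans (pow-w≈ R) ≈⟨ cong-reflexive refl , refl , by 1ℤ (lemma (+ R)) ⟩
      where
      lemma : ∀ n → n ≡ 0ℤ + 1ℤ * n
      lemma = solve-∀

    metacyclic : HalfRotary R (2 ℕ.* S)
    metacyclic = record
      { group = group
      ; w = w
      ; y = y
      ; y≉ε = λ ()
      ; pow-w = pow-w
      ; pow-y = pow-y
      ; η = η
      ; η-cong = η-cong
      ; η-homo = η-homo
      ; η-w = triple refl refl refl
      ; η-y = triple refl refl refl
      ; η-η = η-η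
      ; vtx = vtx
      ; fac = fac
      ; vtx-cong = λ { ≈⟨ _ , _ , q ⟩ → residue-cong R q }
      ; fac-cong = λ { ≈⟨ p , e≡ , _ ⟩ → cong₂ combine (cong bit e≡) (residue-cong S p) }
      ; vtx-y = λ g → cong (residue R) (trans (cong (λ c → b g + c) (sgn-0 (e g))) (ℤ.+-identityʳ (b g)))
      ; fac-w = λ g → cong₂ combine (cong bit (xor-identityʳ (e g))) (cong (residue S)
          (trans (cong (λ c → k g + 0ℤ + c) (carry-falseʳ (e g))) (trans (ℤ.+-identityʳ _) (ℤ.+-identityʳ (k g)))))
      ; vtx-coset = λ {g} {h} → vtx-coset {g} {h}
      ; fac-coset = λ {g} {h} → fac-coset {g} {h}
      ; vtx-fac-injective = λ {g} {h} v≡ f≡ →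
          ≈⟨ proj₂ (eq-fac {g} {h} f≡) , proj₁ (eq-fac {g} {h} f≡) , residue-injective R v≡ ⟩
      ; dart = λ v f → ⟨ + toℕ (proj₂ (remQuot {2} S f)) , bool (proj₁ (remQuot {2} S f)) , + toℕ v ⟩
      ; vtx-dart = λ v f → residue-toℕ R v
      ; fac-dart = λ v f → trans (cong₂ combine (bit-bool (proj₁ (remQuot {2} S f))) (residue-toℕ S (proj₂ (remQuot {2} S f)))) (combine-remQuot {2} S f)
      }

    open HalfRotary metacyclic using (word)

    -- All exponents are multiples of orders: `R` for `w`, `2S` for `y`, and ywy = w⁻¹y² is killed
    -- by R · 2S. So both sides are trivial, and `c` is free to match the exponent demanded by the
    -- other factor.
    relation : ∀ c → word R (2 ℕ.* S) (c ℕ.* (R ℕ.* (2 ℕ.* S))) w y ≈ pow (2 ℕ.* S) y ∙ pow R w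
    relation c = G.trans (G.∙-cong pow-w (G.∙-cong pow-y (pow-multiple group {y ∙ (w ∙ y)} pow-ywy c)))
      (G.sym (G.trans (G.∙-cong pow-y pow-w) (G.sym (G.∙-congˡ {ε} (G.identityˡ ε)))))
      where
      n : ℕ
      n = R ℕ.* (2 ℕ.* S)
      pow-ywy : pow n (y ∙ (w ∙ y)) ≈ ε
      pow-ywy = G.trans (pow-even n 1ℤ (- 1ℤ))
        ≈⟨ by (+ R * + 2) (trans (cong (_* 1ℤ) n≡) (lemma (+ R) (+ S))) , refl
         , by (- (+ 2 * + S)) (trans (cong (_* - 1ℤ) n≡) (lemma′ (+ R) (+ S))) ⟩
        where
        n≡ : + n ≡ + R * (+ 2 * + S)
        n≡ = trans (ℤ.pos-* R (2 ℕ.* S)) (cong (+ R *_) (ℤ.pos-* 2 S))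
        lemma : ∀ R S → R * (+ 2 * S) * 1ℤ ≡ 0ℤ + R * + 2 * S
        lemma = solve-∀
        lemma′ : ∀ R S → R * (+ 2 * S) * - 1ℤ ≡ 0ℤ + - (+ 2 * S) * R
        lemma′ = solve-∀

-- Choosing the parameters.

open Rotary
open Extension
open DirectProducts
open HeisenbergGroup
open MetacyclicGroup
open import Data.Empty using (⊥-elim)
open import Data.Nat using (ℕ; zero; suc; _*_; _^_; _≤_; _<_; _∸_; s≤s; NonZero; >-nonZero; nonTrivial⇒n>1)
open import Data.Nat.Coprimality using (Coprime; coprime-divisor)
open import Data.Nat.Divisibility using (_∣_; divides; ∣-trans; ∣1⇒≡1; _∣?_; quotient-<; quotient≢0; m∣n⇒n≡quotient*m)
open import Data.Nat.Induction using (<-rec)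
open import Data.Nat.Primality using (Prime; prime[2]; euclidsLemma; prime⇒irreducible; prime⇒nonZero; prime⇒nonTrivial; irreducible[2])
open import Data.Nat.Properties using (*-comm; *-assoc; m^n≢0; m*n≢0⇒m≢0; m*n≢0⇒n≢0; ^-distribˡ-+-*; m∸n+n≡m; ≤-<-connex; m≤n⇒m≤1+n; *-identityˡ)
open import Data.Nat.Tactic.RingSolver using (solve-∀)
open import Data.Product using (Σ; ∃₂; _×_; _,_)
open import Data.Sum using (_⊎_; inj₁; inj₂; [_,_]′)
open import Relation.Nullary using (¬_; yes; no)
open import Relation.Binary.PropositionalEquality

TightChiralPolyhedron : ℕ → ℕ → Set
TightChiralPolyhedron p q =
  Σ Structure λ P → IsPolyhedron P × HasType P p q × Tight P p q × Chiral P

realise : ∀ {p q} (T : TightRotary p q) → IsChiral T → TightChiralPolyhedron p q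
realise T irr = poly , isPolyhedron , hasType , tight , chiral irr
  where open Polyhedron T

coprime-* : ∀ {a b n} → Coprime a n → Coprime b n → Coprime (a * b) n
coprime-* ca cb (d∣ab , d∣n) = cb (coprime-divisor (λ (e∣d , e∣a) → ca (e∣a , ∣-trans e∣d d∣n)) d∣ab , d∣n)

coprime-^ : ∀ {a n} k → Coprime a n → Coprime (a ^ k) n
coprime-^ zero    ca (d∣1 , _) = ∣1⇒≡1 d∣1
coprime-^ {a} (suc k) ca = coprime-* {a} {a ^ k} ca (coprime-^ k ca)

module _ {m : ℕ} (m-prime : Prime m) where
  private instance
    m-nonZero = prime⇒nonZero m-prime
    m-nonTrivial = prime⇒nonTrivial m-prime

  coprime-prime : ∀ {n} → ¬ m ∣ n → Coprime m n
  coprime-prime m∤n (d∣m , d∣n) with prime⇒irreducible m-prime d∣m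
  ... | inj₁ d≡1  = d≡1
  ... | inj₂ refl = ⊥-elim (m∤n d∣n)

  ∤-* : ∀ {a b} → ¬ m ∣ a → ¬ m ∣ b → ¬ m ∣ a * b
  ∤-* {a} {b} m∤a m∤b m∣ab = [ m∤a , m∤b ]′ (euclidsLemma a b m-prime m∣ab)

  split : ∀ n → .{{NonZero n}} → ∃₂ λ a ν → n ≡ m ^ a * ν × ¬ m ∣ ν
  split = <-rec (λ n → .{{NonZero n}} → ∃₂ λ a ν → n ≡ m ^ a * ν × ¬ m ∣ ν) step
    where
    step : ∀ n → (∀ {k} → k < n → .{{NonZero k}} → ∃₂ λ a ν → k ≡ m ^ a * ν × ¬ m ∣ ν) →
      .{{NonZero n}} → ∃₂ λ a ν → n ≡ m ^ a * ν × ¬ m ∣ ν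
    step n rec with m ∣? n
    ... | no m∤n  = 0 , n , sym (*-identityˡ n) , m∤n
    ... | yes m∣n with rec (quotient-< m∣n) {{quotient≢0 m∣n}}
    ...   | a , ν , q≡ , m∤ν = suc a , ν ,
      trans (m∣n⇒n≡quotient*m m∣n) (trans (*-comm _ m) (trans (cong (m *_) q≡) (sym (*-assoc m (m ^ a) ν)))) , m∤ν

module OddPrime {m : ℕ} (m-prime : Prime m) (m-odd : ¬ 2 ∣ m) where
  private instance
    m-nonZero = prime⇒nonZero m-prime
    m-nonTrivial = prime⇒nonTrivial m-prime

  m∤2 : ¬ m ∣ 2
  m∤2 m∣2 with irreducible[2] m∣2
  ... | inj₁ refl = ⊥-elim (no-one (nonTrivial⇒n>1 m))
    where
    no-one : ¬ 1 < 1
    no-one (s≤s ())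
  ... | inj₂ refl = m-odd (divides 1 refl)

  -- The 8 is the coefficient of the obstruction 8ij in the Heisenberg group.
  m∤8* : ∀ {n} → ¬ m ∣ n → ¬ m ∣ 8 * n
  m∤8* {n} = ∤-* m-prime {8} {n} (∤-* m-prime {2} {4} m∤2 (∤-* m-prime {2} {2} m∤2 m∤2))

  divisible-case : ∀ r s → .{{NonZero r}} → .{{NonZero s}} → r ∣ s * m →
    TightChiralPolyhedron (2 * (r * m)) (s * (m * m))
  divisible-case r s (divides t sm≡tr) = realise extension
    (extension-chiral heisenberg (irreflexible 1 1 (m∤8* {1} λ m∣1 → m∤2 (∣-trans m∣1 (divides 2 refl)))))
    where
    open Heisenberg m r s t (nonTrivial⇒n>1 m) sm≡tr
    open Extend heisenberg

  module _ (a b ρ σ : ℕ) .{{_ : NonZero ρ}} .{{_ : NonZero σ}} (a≤1+b : a ≤ suc b)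
           (m∤ρ : ¬ m ∣ ρ) (m∤2σ : ¬ m ∣ 2 * σ) where
    private
      instance
        mᵃ-nonZero = m^n≢0 m a
        mᵇ-nonZero = m^n≢0 m b

      -- The bound a ≤ b + 1 is the condition `r ∣ sm` for the `m`-parts r = mᵃ and s = mᵇ.
      mᵇm≡ : m ^ b * m ≡ m ^ (suc b ∸ a) * m ^ a
      mᵇm≡ = trans (*-comm (m ^ b) m) (trans (cong (m ^_) (sym (m∸n+n≡m a≤1+b))) (^-distribˡ-+-* m (suc b ∸ a) a))

      open Heisenberg m (m ^ a) (m ^ b) (m ^ (suc b ∸ a)) (nonTrivial⇒n>1 m) mᵇm≡
        using (heisenberg; irreflexible)
      open Metacyclic ρ σ using (metacyclic; relation)
      open Product heisenberg metacyclic
        (coprime-* {m ^ a} {m} (coprime-^ a (coprime-prime m-prime m∤ρ)) (coprime-prime m-prime m∤ρ))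
        (coprime-* {m ^ b} {m * m} (coprime-^ b (coprime-prime m-prime m∤2σ))
          (coprime-* {m} {m} (coprime-prime m-prime m∤2σ) (coprime-prime m-prime m∤2σ)))
        using (product; product-irreflexible)
      open Extend product using (extension)

    mixed : TightRotary (2 * (m ^ a * m * ρ)) (m ^ b * (m * m) * (2 * σ))
    mixed = extension

    mixed-chiral : IsChiral mixed
    mixed-chiral = extension-chiral product (product-irreflexible
      -- The exponents are the orders of `w` and `y` in the metacyclic factor, where the relation
      -- thus becomes trivial; being prime to `m`, they keep the obstruction alive.
      (irreflexible ρ (2 * σ) (m∤8* {ρ * (2 * σ)} (∤-* m-prime {ρ} {2 * σ} m∤ρ m∤2σ)))
      -- With this factor the exponent of `ywy` agrees with the `k` of the Heisenberg relation.
      (relation (2 * (m ^ b * m))))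

  even-case : ∀ r s → .{{NonZero r}} → .{{NonZero s}} → 2 ∣ s →
    TightChiralPolyhedron (2 * r * m) (s * (m * m))
  even-case r s 2∣s with split m-prime r | split m-prime s
  ... | a , ρ , refl , m∤ρ | b , ς , refl , m∤ς with euclidsLemma (m ^ b) ς prime[2] 2∣s
  ...   | inj₁ 2∣mᵇ = ⊥-elim (2∤m^ b 2∣mᵇ)
    where
    2∤m^ : ∀ k → ¬ 2 ∣ m ^ k
    2∤m^ zero    2∣1 with () ← ∣1⇒≡1 2∣1
    2∤m^ (suc k) = ∤-* prime[2] {m} {m ^ k} m-odd (2∤m^ k)
  ...   | inj₂ (divides σ refl) with ≤-<-connex a (suc b)
  ...     | inj₁ a≤1+b = subst₂ TightChiralPolyhedron (p-eq (m ^ a) m ρ) (q-eq (m ^ b) m σ)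
      (realise (mixed a b ρ σ a≤1+b m∤ρ m∤2σ) (mixed-chiral a b ρ σ a≤1+b m∤ρ m∤2σ))
    where
    instance
      ρ-nonZero : NonZero ρ
      ρ-nonZero = m*n≢0⇒n≢0 (m ^ a)
      σ-nonZero : NonZero σ
      σ-nonZero = m*n≢0⇒m≢0 σ {{m*n≢0⇒n≢0 (m ^ b)}}
    m∤2σ : ¬ m ∣ 2 * σ
    m∤2σ = subst (λ n → ¬ m ∣ n) (*-comm σ 2) m∤ς
    p-eq : ∀ u m ρ → 2 * (u * m * ρ) ≡ 2 * (u * ρ) * m
    p-eq = solve-∀
    q-eq : ∀ u m σ → u * (m * m) * (2 * σ) ≡ u * (σ * 2) * (m * m)
    q-eq = solve-∀
  -- Here r = mᵃ⁺¹ρ with b < a, so the `m`-parts of the degrees are mᵃ⁺² and mᵇ⁺². With the roles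
  -- exchanged the required bound is b + 1 ≤ a + 1.
  even-case r s 2∣s | suc a , ρ , refl , m∤ρ | b , _ , refl , m∤ς | inj₂ (divides σ refl) | inj₂ (s≤s b<a) =
    subst₂ TightChiralPolyhedron (p-eq (m ^ a) m ρ) (q-eq (m ^ b) m σ)
      (realise (dual (mixed (suc b) a σ ρ 1+b≤1+a m∤σ m∤2ρ))
        (dual-chiral (mixed (suc b) a σ ρ 1+b≤1+a m∤σ m∤2ρ) (mixed-chiral (suc b) a σ ρ 1+b≤1+a m∤σ m∤2ρ)))
    where
    instance
      ρ-nonZero : NonZero ρ
      ρ-nonZero = m*n≢0⇒n≢0 (m ^ suc a)
      σ-nonZero : NonZero σ
      σ-nonZero = m*n≢0⇒m≢0 σ {{m*n≢0⇒n≢0 (m ^ b)}}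
    1+b≤1+a : suc b ≤ suc a
    1+b≤1+a = m≤n⇒m≤1+n b<a
    m∤σ : ¬ m ∣ σ
    m∤σ m∣σ = m∤ς (∣-trans m∣σ (divides 2 (*-comm σ 2)))
    m∤2ρ : ¬ m ∣ 2 * ρ
    m∤2ρ = ∤-* m-prime {2} {ρ} m∤2 m∤ρ
    p-eq : ∀ u m ρ → u * (m * m) * (2 * ρ) ≡ 2 * (m * u * ρ) * m
    p-eq = solve-∀
    q-eq : ∀ u m σ → 2 * (m * u * m * σ) ≡ u * (σ * 2) * (m * m)
    q-eq = solve-∀

theorem3p13 : (m r s : ℕ) → Prime m → ¬ (2 ∣ m) → 1 ≤ r → 1 ≤ s →
    (2 ∣ s ⊎ (¬ (2 ∣ s) × r ∣ s * m)) →
    Σ Structure λ P → IsPolyhedron P × HasType P (2 * r * m) (s * (m * m))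
      × Tight P (2 * r * m) (s * (m * m)) × Chiral P
theorem3p13 m r s m-prime m-odd 1≤r 1≤s (inj₁ 2∣s) = even-case r s {{>-nonZero 1≤r}} {{>-nonZero 1≤s}} 2∣s
  where open OddPrime m-prime m-odd
theorem3p13 m r s m-prime m-odd 1≤r 1≤s (inj₂ (_ , r∣sm)) =
  subst (λ p → TightChiralPolyhedron p (s * (m * m))) (sym (*-assoc 2 r m))
    (divisible-case r s {{>-nonZero 1≤r}} {{>-nonZero 1≤s}} r∣sm)
  where open OddPrime m-prime m-odd
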